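{- Let $k\ge0$ and $\ell\ge 0$ be fixed integers. For $\omega\in\mathfrak{B}_n$ chosen uniformly at random, with $\alpha=\alpha(\omega)$ and $\beta=\beta(\omega)$, as $n\to\infty$, $$\mathbb{E}\left[\alpha^k\beta^\ell\right]\sim\frac{n^{3(k+\ell)}}{2^{k+\ell-1}(k+\ell+1)\binom{3(k+\ell)+2}{3k+1}(2k+1)\binom{2k}{k}(2\ell+1)\binom{2\ell}{\ell}}.$$
   Context: $\mathfrak{S}_n$ is the set of permutations of $[n]=\{1,\dots,n\}$, in one-line notation. A reduction of $\omega\in\mathfrak{S}_n$ interchanges $\omega(i)$ and $\omega(j)$ for some $i<j$ with $\omega(i)>\omega(j)$. Bruhat order: $\pi\le\sigma$ if $\pi$ is obtained from $\sigma$ by a (possibly empty) sequence of reductions. $\mathfrak{B}_n\subseteq\mathfrak{S}_n$ is the set of bigrassmannian permutations, i.e. those $\omega$ such that both $\omega$ and $\omega^{ -1}$ have exactly one descent; equivalently $\omega=1\cdots a\,(b+1)\cdots c\,(a+1)\cdots b\,(c+1)\cdots n$ for some $0\le a<b<c\le n$. For $\omega\in\mathfrak{B}_n$, $\beta(\omega)$ is the number of $\pi\in\mathfrak{B}_n$ with $\pi\le\omega$, and $\alpha(\omega)$ is the number of $\tau\in\mathfrak{B}_n$ with $\omega\le\tau$. $f(n)\sim g(n)$ means $f(n)/g(n)\to1$. -}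

module Defs where

open import Data.Fin.Base using (Fin; zero; suc; toℕ; _<_; punchIn)
open import Data.Fin.Induction using (<-wellFounded)
open import Data.Fin.Permutation
  using (Permutation′; _⟨$⟩ʳ_; _≈_; id; flip; _∘ₚ_; transpose; insert; remove; insert-remove)
import Data.Fin.Permutation.Components as PC
open import Data.Fin.Properties using (_≟_; _<?_; any?; all?; <⇒≢; punchIn-injective)
open import Data.Integer.Base using (+_)
open import Data.List.Base using (List; []; _∷_; map; filter; length; cartesianProductWith; allFin)
open import Data.List.Membership.Propositional.Properties using (∈-allFin)
import Data.List.Membership.Setoid as Membership
import Data.List.Membership.Setoid.Properties as Membershipₚ
open import Data.List.Relation.Unary.All using ([])
open import Data.List.Relation.Unary.AllPairs using ([]; _∷_)
open import Data.List.Relation.Unary.Any using (here)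
open import Data.List.Relation.Unary.Enumerates.Setoid using (IsEnumeration)
import Data.List.Relation.Unary.Unique.Propositional.Properties as Uniqueₚ
open import Data.List.Relation.Unary.Unique.Setoid using (Unique)
import Data.List.Relation.Unary.Unique.Setoid.Properties as UniqueSetoidₚ
open import Data.Nat.Base as ℕ using (ℕ; zero; suc; NonZero; z<s; s<s; _*_; _^_)
open import Data.Nat.Combinatorics using (_C_; nCk≡n!/k![n-k]!; k![n∸k]!∣n!)
open import Data.Nat.DivMod using (m≥n⇒m/n>0)
open import Data.Nat.Divisibility using (∣⇒≤)
import Data.Nat.ListAction as ℕ
import Data.Nat.Properties as ℕ
open import Data.Product using (Σ; ∃; ∃!; _×_; _,_)
open import Data.Rational.Base as ℚ using (ℚ; 0ℚ; 1ℚ; _/_; _÷_; _-_; ∣_∣)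
open import Data.Vec.Base as Vec using (tabulate)
import Data.Vec.Relation.Binary.Lex.Strict as Lex
open import Function.Base using (_∘_; _on_)
open import Induction.WellFounded using (Acc; acc; WellFounded)
open import Level using (0ℓ)
open import Relation.Binary.Bundles using (Setoid)
open import Relation.Binary.Core using (Rel)
open import Relation.Binary.Construct.Closure.ReflexiveTransitive using (Star; ε; _◅_)
import Relation.Binary.Construct.On as On
open import Relation.Binary.PropositionalEquality
  using (_≡_; refl; sym; trans; cong; subst; setoid)
open import Relation.Nullary using (Dec; yes; no; contradiction)
open import Relation.Nullary.Decidable using (map′; _×-dec_; _→-dec_)
open import Relation.Unary using (Pred; Decidable)

private
  variable
    n : ℕ

------------------------------------------------------------------------
-- Permutations

-- [n] is represented by Fin n, so positions and values are shifted down by one.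
-- Permutations are compared with the pointwise equality _≈_.

𝔖 : ℕ → Set
𝔖 = Permutation′

𝔖-setoid : ℕ → Setoid 0ℓ 0ℓ
𝔖-setoid n = record
  { Carrier       = 𝔖 n
  ; _≈_           = _≈_
  ; isEquivalence = record
    { refl  = λ _ → refl
    ; sym   = λ p i → sym (p i)
    ; trans = λ p q i → trans (p i) (q i)
    }
  }

permutations : ∀ n → List (𝔖 n)
permutations zero    = id ∷ []
permutations (suc n) = cartesianProductWith (insert zero) (allFin (suc n)) (permutations n)

private
  insert-cong : ∀ {i j : Fin (suc n)} {π ρ : 𝔖 n} → i ≡ j → π ≈ ρ →
                insert zero i π ≈ insert zero j ρ
  insert-cong refl π≈ρ zero            = refl
  insert-cong {i = i} refl π≈ρ (suc k) = cong (punchIn i) (π≈ρ k)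

  insert-injective : ∀ {i j : Fin (suc n)} {π ρ : 𝔖 n} →
                     insert zero i π ≈ insert zero j ρ → i ≡ j × π ≈ ρ
  insert-injective {i = i} {j} {π} {ρ} eq with eq zero
  ... | refl = refl , λ k → punchIn-injective i _ _ (eq (suc k))

permutations-enumeration : ∀ n → IsEnumeration (𝔖-setoid n) (permutations n)
permutations-enumeration zero    π = here λ ()
permutations-enumeration (suc n) π =
  Membershipₚ.∈-resp-≈ (𝔖-setoid (suc n))
    {x = insert zero (π ⟨$⟩ʳ zero) (remove zero π)} {π} (insert-remove zero π)
    (Membershipₚ.∈-cartesianProductWith⁺ (setoid (Fin (suc n))) (𝔖-setoid n) (𝔖-setoid (suc n))
      {f = insert zero} (λ {i} {j} {ρ} {σ} → insert-cong {i = i} {j} {ρ} {σ})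
      (∈-allFin (π ⟨$⟩ʳ zero)) (permutations-enumeration n (remove zero π)))

permutations-unique : ∀ n → Unique (𝔖-setoid n) (permutations n)
permutations-unique zero    = [] ∷ []
permutations-unique (suc n) =
  UniqueSetoidₚ.cartesianProductWith⁺ (setoid (Fin (suc n))) (𝔖-setoid n) (𝔖-setoid (suc n))
    (insert zero) (λ {i} {j} {π} {ρ} → insert-injective {i = i} {j} {π} {ρ})
    (Uniqueₚ.allFin⁺ (suc n)) (permutations-unique n)

------------------------------------------------------------------------
-- Bruhat order

-- transpose i j ∘ₚ σ applies the transposition first, so it is σ with the
-- entries in positions i and j of its one-line notation interchanged.

data Reduction {n} (σ : 𝔖 n) : 𝔖 n → Set where
  reduce : ∀ {i j} → i < j → σ ⟨$⟩ʳ j < σ ⟨$⟩ʳ i → Reduction σ (transpose i j ∘ₚ σ)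

infix 4 _≤ᴮ_ _≤ᴮ?_

-- The final ≈ is needed because pointwise equal permutations need not be
-- propositionally equal.

_≤ᴮ_ : Rel (𝔖 n) 0ℓ
π ≤ᴮ σ = ∃ λ τ → Star Reduction σ τ × τ ≈ π

-- The search for a sequence of reductions terminates because each reduction
-- makes the one-line notation lexicographically smaller.

private
  word : 𝔖 n → Vec.Vec (Fin n) n
  word σ = tabulate (σ ⟨$⟩ʳ_)

  _<ˡ_ : ∀ {m} → Rel (Vec.Vec (Fin n) m) 0ℓ
  _<ˡ_ = Lex.Lex-< _≡_ _<_

  tabulate-<ˡ : ∀ {m} {f g : Fin m → Fin n} (i : Fin m) →
                (∀ k → k < i → f k ≡ g k) → f i < g i → tabulate f <ˡ tabulate g
  tabulate-<ˡ zero    f≡g f<g = Lex.this f<g refl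
  tabulate-<ˡ (suc i) f≡g f<g =
    Lex.next (f≡g zero z<s) (tabulate-<ˡ i (λ k k<i → f≡g (suc k) (s<s k<i)) f<g)

  transpose-here : (i j : Fin n) → PC.transpose i j i ≡ j
  transpose-here i j with i ≟ i
  ... | yes _   = refl
  ... | no  i≢i = contradiction refl i≢i

  transpose-below : ∀ {i j : Fin n} → i < j → ∀ k → k < i → PC.transpose i j k ≡ k
  transpose-below {i = i} {j} i<j k k<i with k ≟ i
  ... | yes k≡i = contradiction k≡i (<⇒≢ k<i)
  ... | no  _ with k ≟ j
  ...   | yes k≡j = contradiction k≡j (<⇒≢ (ℕ.<-trans k<i i<j))
  ...   | no  _   = refl

  reduce-<ˡ : ∀ {σ : 𝔖 n} {i j} → i < j → σ ⟨$⟩ʳ j < σ ⟨$⟩ʳ i →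
              word (transpose i j ∘ₚ σ) <ˡ word σ
  reduce-<ˡ {σ = σ} {i} {j} i<j σj<σi = tabulate-<ˡ i
    (λ k k<i → cong (σ ⟨$⟩ʳ_) (transpose-below i<j k k<i))
    (subst (λ v → σ ⟨$⟩ʳ v < σ ⟨$⟩ʳ i) (sym (transpose-here i j)) σj<σi)

  word-wellFounded : WellFounded (_<ˡ_ on word {n})
  word-wellFounded = On.wellFounded word
    (Lex.<-wellFounded trans (λ { refl i<j → i<j }) <-wellFounded)

  ≤ᴮ-dec : (π σ : 𝔖 n) → Acc (_<ˡ_ on word) σ → Dec (π ≤ᴮ σ)
  ≤ᴮ-dec {n} π σ (acc rs) with all? (λ i → σ ⟨$⟩ʳ i ≟ π ⟨$⟩ʳ i)
  ... | yes σ≈π = yes (σ , ε , σ≈π)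
  ... | no  σ≉π = map′ extend first (any? λ i → any? (step? i))
    where
    Step : Fin n → Fin n → Set
    Step i j = Σ (i < j) λ _ → Σ (σ ⟨$⟩ʳ j < σ ⟨$⟩ʳ i) λ _ → π ≤ᴮ transpose i j ∘ₚ σ

    step? : ∀ i j → Dec (Step i j)
    step? i j with i <? j
    ... | no  i≮j = no λ (i<j , _) → i≮j i<j
    ... | yes i<j with σ ⟨$⟩ʳ j <? σ ⟨$⟩ʳ i
    ...   | no  σj≮σi = no λ (_ , σj<σi , _) → σj≮σi σj<σi
    ...   | yes σj<σi = map′ (λ r → i<j , σj<σi , r) (λ (_ , _ , r) → r)
                          (≤ᴮ-dec π (transpose i j ∘ₚ σ) (rs (reduce-<ˡ {σ = σ} i<j σj<σi)))

    extend : (∃ λ i → ∃ λ j → Step i j) → π ≤ᴮ σ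
    extend (_ , _ , i<j , σj<σi , τ , steps , τ≈π) = τ , reduce i<j σj<σi ◅ steps , τ≈π

    first : π ≤ᴮ σ → ∃ λ i → ∃ λ j → Step i j
    first (_ , ε , σ≈π)                        = contradiction σ≈π σ≉π
    first (τ , reduce i<j σj<σi ◅ steps , τ≈π) = _ , _ , i<j , σj<σi , τ , steps , τ≈π

_≤ᴮ?_ : (π σ : 𝔖 n) → Dec (π ≤ᴮ σ)
π ≤ᴮ? σ = ≤ᴮ-dec π σ (word-wellFounded σ)

------------------------------------------------------------------------
-- Bigrassmannian permutations

Descent : 𝔖 n → Pred (Fin n) 0ℓ
Descent ω i = ∃ λ j → toℕ j ≡ suc (toℕ i) × ω ⟨$⟩ʳ j < ω ⟨$⟩ʳ i

descent? : (ω : 𝔖 n) → Decidable (Descent ω)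
descent? ω i = any? λ j → toℕ j ℕ.≟ suc (toℕ i) ×-dec ω ⟨$⟩ʳ j <? ω ⟨$⟩ʳ i

OneDescent : Pred (𝔖 n) 0ℓ
OneDescent ω = ∃! _≡_ (Descent ω)

oneDescent? : Decidable (OneDescent {n})
oneDescent? ω = map′
  (λ (i , d , u) → i , d , λ {j} → u j)
  (λ (i , d , u) → i , d , λ j → u {j})
  (any? λ i → descent? ω i ×-dec all? λ j → descent? ω j →-dec i ≟ j)

Bigrassmannian : Pred (𝔖 n) 0ℓ
Bigrassmannian ω = OneDescent ω × OneDescent (flip ω)

bigrassmannian? : Decidable (Bigrassmannian {n})
bigrassmannian? ω = oneDescent? ω ×-dec oneDescent? (flip ω)

𝔅 : ∀ n → List (𝔖 n)
𝔅 n = filter bigrassmannian? (permutations n)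

α β : 𝔖 n → ℕ
α {n} ω = length (filter (λ τ → ω ≤ᴮ? τ) (𝔅 n))
β {n} ω = length (filter (λ π → π ≤ᴮ? ω) (𝔅 n))

------------------------------------------------------------------------
-- Expectation

-- The average of an empty list is a dummy value; 𝔅 n is empty only for n ≤ 1.

average : List ℕ → ℚ
average []          = 0ℚ
average xs@(_ ∷ _) = + ℕ.sum xs / length xs

-- The expectation of X (ω) for ω uniform in 𝔅 n.

𝔼 : ∀ n → (𝔖 n → ℕ) → ℚ
𝔼 n X = average (map X (𝔅 n))

------------------------------------------------------------------------
-- Asymptotic equivalence

infix 4 _∼_

-- f(n)/g(n) → 1, where the quotient only has to be defined for large n.

_∼_ : (ℕ → ℚ) → (ℕ → ℚ) → Set
f ∼ g = ∀ δ → 0ℚ ℚ.< δ →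
        ∃ λ N → ∀ n → N ℕ.≤ n →
        Σ (ℚ.NonZero (g n)) λ g≢0 → ∣ (f n ÷ g n) {{g≢0}} - 1ℚ ∣ ℚ.< δ

------------------------------------------------------------------------
-- The constant in the asymptotic formula

-- The stated denominator has 2^(k+ℓ-1), whose exponent is negative for
-- k = ℓ = 0. It is doubled here to have 2^(k+ℓ), and so is the numerator.

denominator : ℕ → ℕ → ℕ
denominator k ℓ =
  2 ^ (k ℕ.+ ℓ) * (k ℕ.+ ℓ ℕ.+ 1) * ((3 * (k ℕ.+ ℓ) ℕ.+ 2) C (3 * k ℕ.+ 1))
  * (2 * k ℕ.+ 1) * ((2 * k) C k) * (2 * ℓ ℕ.+ 1) * ((2 * ℓ) C ℓ)

private
  C≢0 : ∀ {n k} → k ℕ.≤ n → NonZero (n C k)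
  C≢0 {n} {k} k≤n = subst NonZero (sym (nCk≡n!/k![n-k]! k≤n))
    (ℕ.>-nonZero (m≥n⇒m/n>0 {{_}} (∣⇒≤ {{n ℕ.!≢0}} (k![n∸k]!∣n! k≤n))))
    where instance _ = k ℕ.!* (n ℕ.∸ k) !≢0

  m+1≢0 : ∀ m → NonZero (m ℕ.+ 1)
  m+1≢0 m = ℕ.>-nonZero (ℕ.m≤n+m 1 m)

denominator≢0 : ∀ k ℓ → NonZero (denominator k ℓ)
denominator≢0 k ℓ =
  ℕ.m*n≢0 _ _ {{ℕ.m*n≢0 _ _ {{ℕ.m*n≢0 _ _ {{ℕ.m*n≢0 _ _ {{ℕ.m*n≢0 _ _ {{ℕ.m*n≢0 _ _
    {{ℕ.m^n≢0 2 (k ℕ.+ ℓ)}} {{m+1≢0 (k ℕ.+ ℓ)}}}} {{C≢0 bound}}}}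
    {{m+1≢0 (2 * k)}}}} {{C≢0 (ℕ.m≤n*m k 2)}}}} {{m+1≢0 (2 * ℓ)}}}} {{C≢0 (ℕ.m≤n*m ℓ 2)}}
  where
  bound : 3 * k ℕ.+ 1 ℕ.≤ 3 * (k ℕ.+ ℓ) ℕ.+ 2
  bound = ℕ.+-mono-≤ (ℕ.*-monoʳ-≤ 3 (ℕ.m≤m+n k ℓ)) (ℕ.s≤s ℕ.z≤n)

{-# OPTIONS --safe #-}
module Submission where

-- For a cut (i, j) let the rank of σ be the number of positions k < i with σ k ≥ j. A reduction
-- never increases a rank, decreases it by at most one, and changes it only if the exchanged
-- positions lie in opposite quadrants NE and SW of the cut. Hence reducing σ as long as its rank
-- at (i, j) stays ≥ r ends in a permutation all of whose inversions cross the cut, and such a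
-- permutation is determined by (i, j, r): it is the bigrassmannian permutation with blocks of
-- lengths p, r, q, s, where i = p + r, j = p + q and p + q + r + s = n. So it lies below σ iff
-- the rank of σ at (i, j) is ≥ r, and for σ bigrassmannian this means that the two outer blocks
-- of σ are at most, and its two inner blocks at least, as long as those of the given permutation.
--
-- Counting gives α = (p+1)(s+1)(p+s+2)/2 and β = qr(q+r)/2, so that Σ α^k β^ℓ is an iterated
-- convolution of powers. Bounding powers by binomial coefficients and applying Vandermonde's
-- identity yields its growth up to a bounded shift of n, including that of |𝔅 n| (k = ℓ = 0).

open import Defs

open import Algebra.Properties.CommutativeMonoid.Sum as Sum using ()
open import Data.Bool.Base using (if_then_else_)
open import Data.Fin.Base using (Fin; zero; suc; toℕ; fromℕ<)
open import Data.Fin.Permutation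
  using (Permutation′; _⟨$⟩ʳ_; _≈_; _∘ₚ_; flip; inverseˡ; inverseʳ; reverse; transpose)
open import Data.Fin.Properties as Fin using (any?; opposite-prop; toℕ<n; toℕ-fromℕ<; toℕ-injective)
open import Data.List.Base
  using (List; []; _∷_; _++_; cartesianProduct; concatMap; filter; length; map)
open import Data.List.Membership.Propositional using (_∈_; find; lose)
open import Data.List.Membership.Propositional.Properties
  using (∈-cartesianProduct⁺; ∈-cartesianProduct⁻; ∈-concatMap⁺; ∈-concatMap⁻;
         ∈-filter⁺; ∈-filter⁻; ∈-map⁺; ∈-map⁻)
open import Data.List.Membership.Propositional.Properties.WithK using (unique∧set⇒bag)
open import Data.List.Properties
  using (filter-all; length-++; length-map; map-++; map-∘; map-cong; map-cong-local)
open import Data.List.Relation.Binary.BagAndSetEquality using (∼bag⇒↭)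
open import Data.List.Relation.Binary.Permutation.Propositional using (_↭_)
import Data.List.Relation.Binary.Permutation.Propositional.Properties as ↭
open import Data.List.Relation.Unary.All as All using ([]; _∷_)
import Data.List.Relation.Unary.All.Properties as All
open import Data.List.Relation.Unary.AllPairs using ([]; _∷_)
open import Data.List.Relation.Unary.Any using (here; there)
open import Data.List.Relation.Unary.Unique.Propositional using (Unique)
import Data.List.Relation.Unary.Unique.Propositional.Properties as Unique
open import Data.List.Relation.Unary.Unique.Setoid using () renaming (Unique to Uniqueₛ)
import Data.List.Relation.Unary.Unique.Setoid.Properties as Uniqueₛ
open import Data.Nat.Base hiding (_/_; ∣_-_∣)
open import Data.Nat.Combinatorics
  using (_C_; k>n⇒nCk≡0; k![n∸k]!∣n!; nCk≡n!/k![n-k]!; nCk+nC[k+1]≡[n+1]C[k+1])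
open import Data.Nat.DivMod using (m/n*n≡m)
open import Data.Nat.Induction using (<-wellFounded)
open import Data.Nat.ListAction using (sum)
open import Data.Nat.ListAction.Properties using (sum-++; sum-↭)
open import Data.Nat.Properties
open import Data.Nat.Tactic.RingSolver using (solve-∀)
open import Data.Product using (Σ; ∃; ∃-syntax; _×_; _,_; map₁; proj₁; proj₂; swap)
open import Data.Product.Properties using (,-injectiveˡ; ,-injectiveʳ)
open import Data.Sum.Base using (_⊎_; inj₁; inj₂)
open import Function.Base using (_∘_; _$_; case_of_)
open import Function.Bundles using (Injection; mk⇔)
open import Function.Properties.Inverse using (↔⇒↣)
open import Induction.WellFounded using (Acc; acc)
open import Level using (0ℓ)
open import Relation.Binary.Construct.Closure.ReflexiveTransitive using (Star; ε; _◅_)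
open import Relation.Binary.Definitions using (tri<; tri≈; tri>)
open import Relation.Binary.PropositionalEquality
open import Relation.Nullary using (Dec; yes; no; does; ¬_; contradiction)
open import Relation.Nullary.Decidable using (_×-dec_; ⊥-dec)
open import Relation.Unary using (Pred; Decidable)

open Sum +-0-commutativeMonoid
  renaming (sum to ∑; sum-cong-≗ to ∑-cong; sum-permute to ∑-permute; sum-replicate-zero to ∑-zero)
  using (∑-distrib-+)

-- A bigrassmannian permutation is the least one whose rank at its own cut is at least r, which is
-- why a single rank decides whether it lies below σ. Exchanging the outer lengths with the inner
-- ones (the latter less one) reverses the order, so α and β are the same function of different
-- pairs, and for a fixed sum p + s the sum of α^k β^ℓ factors. The constant is a product of
-- discrete beta integrals: convolving t^d with t^d′ brings in d! d′! / (d + d′ + 1)!. This happens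
-- with exponents k and k, ℓ and ℓ, and then 3k + 1 and 3ℓ + 1, and explains the two central
-- binomial coefficients and the large one. The quotient by |𝔅 n|, of order n³/6, explains the
-- factor 2 in the numerator. Two obstacles shape the text. Permutations are compared only
-- pointwise, so lists of them are mapped to lists of quadruples of naturals, where propositional
-- equality is available. Asymptotics are kept as two-sided inequalities in ℕ between a function and
-- a shifted power; rationals enter only at the very end.

private variable
  n : ℕ
  X Y : Set

-- Counting in Fin n

⟦_⟧ : ∀ {A : Set} → Dec A → ℕ
⟦ d ⟧ = if does d then 1 else 0

∑-mono : ∀ {f g : Fin n → ℕ} → (∀ k → f k ≤ g k) → ∑ f ≤ ∑ g
∑-mono {zero}  f≤g = z≤n
∑-mono {suc n} f≤g = +-mono-≤ (f≤g zero) (∑-mono (f≤g ∘ suc))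

term≤∑ : ∀ (f : Fin n → ℕ) k → f k ≤ ∑ f
term≤∑ f zero    = m≤m+n _ _
term≤∑ f (suc k) = ≤-trans (term≤∑ (f ∘ suc) k) (m≤n+m _ _)

⟦⟧-mono : ∀ {A B : Set} → (A → B) → (a : Dec A) (b : Dec B) → ⟦ a ⟧ ≤ ⟦ b ⟧
⟦⟧-mono f (no _)  b       = z≤n
⟦⟧-mono f (yes _) (yes _) = ≤-refl
⟦⟧-mono f (yes a) (no ¬b) = contradiction (f a) ¬b

module _ {A B C : Set} where

  ⟦⟧-cover : (A → B ⊎ C) → (a : Dec A) (b : Dec B) (c : Dec C) → ⟦ a ⟧ ≤ ⟦ b ⟧ + ⟦ c ⟧
  ⟦⟧-cover f (no _)  b       c       = z≤n
  ⟦⟧-cover f (yes _) (yes _) c       = s≤s z≤n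
  ⟦⟧-cover f (yes _) (no _)  (yes _) = s≤s z≤n
  ⟦⟧-cover f (yes a) (no ¬b) (no ¬c) with f a
  ... | inj₁ b = contradiction b ¬b
  ... | inj₂ c = contradiction c ¬c

  ⟦⟧-disjoint : (B → A) → (C → A) → (B → ¬ C) →
                (a : Dec A) (b : Dec B) (c : Dec C) → ⟦ b ⟧ + ⟦ c ⟧ ≤ ⟦ a ⟧
  ⟦⟧-disjoint f g h a       (no _)  (no _)  = z≤n
  ⟦⟧-disjoint f g h a       (yes b) (yes c) = contradiction c (h b)
  ⟦⟧-disjoint f g h (yes _) (yes _) (no _)  = ≤-refl
  ⟦⟧-disjoint f g h (yes _) (no _)  (yes _) = ≤-refl
  ⟦⟧-disjoint f g h (no ¬a) (yes b) (no _)  = contradiction (f b) ¬a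
  ⟦⟧-disjoint f g h (no ¬a) (no _)  (yes c) = contradiction (g c) ¬a

count : {P : Pred (Fin n) 0ℓ} → Decidable P → ℕ
count P? = ∑ (λ k → ⟦ P? k ⟧)

below? : ∀ n u → Decidable {A = Fin n} (λ k → toℕ k < u)
below? n u k = toℕ k <? u

module _ {P Q R : Pred (Fin n) 0ℓ} (P? : Decidable P) (Q? : Decidable Q) (R? : Decidable R) where

  count-cover : (∀ k → P k → Q k ⊎ R k) → count P? ≤ count Q? + count R?
  count-cover f = ≤-trans (∑-mono λ k → ⟦⟧-cover (f k) (P? k) (Q? k) (R? k))
                          (≤-reflexive (∑-distrib-+ (λ k → ⟦ Q? k ⟧) _))

  count-disjoint : (∀ k → Q k → P k) → (∀ k → R k → P k) → (∀ k → Q k → ¬ R k) →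
                   count Q? + count R? ≤ count P?
  count-disjoint f g h = ≤-trans (≤-reflexive (sym (∑-distrib-+ (λ k → ⟦ Q? k ⟧) _)))
                                 (∑-mono λ k → ⟦⟧-disjoint (f k) (g k) (h k) (P? k) (Q? k) (R? k))

  count-⊎ : (∀ k → P k → Q k ⊎ R k) → (∀ k → Q k → P k) → (∀ k → R k → P k) →
            (∀ k → Q k → ¬ R k) → count P? ≡ count Q? + count R?
  count-⊎ f g h i = ≤-antisym (count-cover f) (count-disjoint g h i)

module _ {P Q : Pred (Fin n) 0ℓ} (P? : Decidable P) (Q? : Decidable Q) where

  count-mono : (∀ k → P k → Q k) → count P? ≤ count Q?
  count-mono f = ∑-mono λ k → ⟦⟧-mono (f k) (P? k) (Q? k)

  count-cong : (∀ k → P k → Q k) → (∀ k → Q k → P k) → count P? ≡ count Q?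
  count-cong f g = ≤-antisym (count-mono f) (∑-mono λ k → ⟦⟧-mono (g k) (Q? k) (P? k))

module _ {P : Pred (Fin n) 0ℓ} (P? : Decidable P) where

  count-permute : (σ : Permutation′ n) → count P? ≡ count (λ k → P? (σ ⟨$⟩ʳ k))
  count-permute = ∑-permute (λ k → ⟦ P? k ⟧)

  count>0⇒∃ : 0 < count P? → ∃ P
  count>0⇒∃ 0<c with any? P?
  ... | yes p = p
  ... | no ¬p = contradiction 0<c $ ≤⇒≯ $ ≤-trans
    (count-mono P? (λ _ → ⊥-dec) (λ k p → contradiction (k , p) ¬p)) (≤-reflexive (∑-zero n))

  ∃⇒count>0 : ∀ k → P k → 0 < count P?
  ∃⇒count>0 k p with P? k | term≤∑ (λ k → ⟦ P? k ⟧) k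
  ... | yes _ | q = q
  ... | no ¬p | _ = contradiction p ¬p

count-below≤ : ∀ n u → count (below? n u) ≤ u
count-below≤ zero    u       = z≤n
count-below≤ (suc n) zero    = ≤-reflexive (∑-zero n)
count-below≤ (suc n) (suc u) = s≤s (≤-trans (count-mono (below? (suc n) (suc u) ∘ suc) (below? n u) (λ _ → s≤s⁻¹)) (count-below≤ n u))

count-below : ∀ {n u} → u ≤ n → count (below? n u) ≡ u
count-below {n}     {zero}  _         = ∑-zero n
count-below {suc n} {suc u} (s≤s u≤n) =
  cong suc (trans (count-cong (below? (suc n) (suc u) ∘ suc) (below? n u) (λ _ → s≤s⁻¹) (λ _ → s≤s)) (count-below u≤n))

module _ {P : Pred (Fin n) 0ℓ} (P? : Decidable P) where

  count-interval-≤ : ∀ {l u} → l ≤ n → 0 < count P? →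
                     (∀ k → P k → l ≤ toℕ k × toℕ k < u) → l + count P? ≤ u
  count-interval-≤ {l} {u} l≤n 0<c f with w , pw ← count>0⇒∃ P? 0<c = begin
    l + count P?               ≡⟨ cong (_+ count P?) (count-below l≤n) ⟨
    count (below? n l) + count P? ≤⟨ count-disjoint (below? n u) (below? n l) P?
                                     -- The witness `w` gives l ≤ w < u, so the segment below l lies
                                     -- below u.
                                     (λ k k<l → <-trans (<-≤-trans k<l (proj₁ (f w pw))) (proj₂ (f w pw)))
                                     (λ k → proj₂ ∘ f k)
                                     (λ k k<l → <⇒≱ k<l ∘ proj₁ ∘ f k) ⟩
    count (below? n u)           ≤⟨ count-below≤ n u ⟩
    u                          ∎
    where open ≤-Reasoning

  count-interval-≥ : ∀ t {r} → t + r ≤ n → (∀ k → t ≤ toℕ k → toℕ k < t + r → P k) → r ≤ count P?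
  count-interval-≥ t {r} t+r≤n f = +-cancelˡ-≤ t _ _ $ begin
    t + r                       ≡⟨ count-below t+r≤n ⟨
    count (below? n (t + r))  ≤⟨ count-cover (below? n (t + r)) (below? n t) P? split ⟩
    count (below? n t) + count P? ≤⟨ +-monoˡ-≤ _ (count-below≤ n t) ⟩
    t + count P?                ∎
    where
    open ≤-Reasoning
    split : ∀ k → toℕ k < t + r → toℕ k < t ⊎ P k
    split k k<t+r with toℕ k <? t
    ... | yes k<t = inj₁ k<t
    ... | no  k≮t = inj₂ (f k (≮⇒≥ k≮t) k<t+r)

δ-∑ : ∀ (x : Fin n) (f : Fin n → ℕ) (c : ℕ) →
        (∀ k → k ≢ x → f k ≡ 0) → f x ≡ c → ∑ f ≡ c
δ-∑ {suc n} zero f c f≢ fx =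
  trans (cong₂ _+_ fx (trans (∑-cong (λ k → f≢ (suc k) λ ())) (∑-zero n))) (+-identityʳ c)
δ-∑ {suc n} (suc x) f c f≢ fx =
  cong₂ _+_ (f≢ zero λ ()) (δ-∑ x (f ∘ suc) c (λ k k≢x → f≢ (suc k) (k≢x ∘ suc-inj)) fx)
  where
  suc-inj : ∀ {k} → suc k ≡ suc x → k ≡ x
  suc-inj refl = refl

-- Ranks and reductions

val : 𝔖 n → Fin n → ℕ
val σ k = toℕ (σ ⟨$⟩ʳ k)

val-injective : ∀ (σ : 𝔖 n) {x y} → val σ x ≡ val σ y → x ≡ y
val-injective σ = Injection.injective (↔⇒↣ σ) ∘ toℕ-injective

count-val : ∀ (σ : 𝔖 n) {u} → u ≤ n → count (λ k → val σ k <? u) ≡ u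
count-val {n} σ {u} u≤n = trans (sym (count-permute (below? n u) σ)) (count-below u≤n)

module _ (σ : 𝔖 n) (i j : ℕ) where

  -- Quadrants of the permutation matrix: north is k < i and west is σ k < j.
  NW NE SW : Fin n → Set
  NW k = toℕ k < i × val σ k < j
  NE k = toℕ k < i × j ≤ val σ k
  SW k = i ≤ toℕ k × val σ k < j

  NW? : Decidable NW
  NW? k = (toℕ k <? i) ×-dec (val σ k <? j)

  NE? : Decidable NE
  NE? k = (toℕ k <? i) ×-dec (j ≤? val σ k)

  SW? : Decidable SW
  SW? k = (i ≤? toℕ k) ×-dec (val σ k <? j)

  rank : ℕ
  rank = count NE?

  Crossing : Set
  Crossing = ∀ {x y} → toℕ x < toℕ y → val σ y < val σ x → NE x × SW y

  module _ (i≤n : i ≤ n) where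
    NW+NE : count NW? + count NE? ≡ i
    NW+NE = sym $ trans (sym (count-below i≤n)) $ count-⊎ (below? n i) NW? NE?
      (λ k k<i → case val σ k <? j of λ where
        (yes v<j) → inj₁ (k<i , v<j)
        (no  v≮j) → inj₂ (k<i , ≮⇒≥ v≮j))
      (λ _ → proj₁) (λ _ → proj₁) (λ _ (_ , v<j) (_ , j≤v) → <⇒≱ v<j j≤v)

  module _ (j≤n : j ≤ n) where
    NW+SW : count NW? + count SW? ≡ j
    NW+SW = sym $ trans (sym (count-val σ j≤n)) $ count-⊎ (λ k → val σ k <? j) NW? SW?
      (λ k v<j → case toℕ k <? i of λ where
        (yes k<i) → inj₁ (k<i , v<j)
        (no  k≮i) → inj₂ (≮⇒≥ k≮i , v<j))
      (λ _ → proj₂) (λ _ → proj₂) (λ _ (k<i , _) (i≤k , _) → <⇒≱ k<i i≤k)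

  module _ (crossing : Crossing) where

    private
      ordered : ∀ {x y} → toℕ x < toℕ y → val σ x < val σ y ⊎ NE x × SW y
      ordered {x} {y} x<y with <-cmp (val σ x) (val σ y)
      ... | tri< vx<vy _ _ = inj₁ vx<vy
      ... | tri≈ _ vx≡vy _ = contradiction (cong toℕ (val-injective σ vx≡vy)) (<⇒≢ x<y)
      ... | tri> _ _ vy<vx = inj₂ (crossing x<y vy<vx)

      position-< : ∀ {x y} → ¬ (NE y × SW x) → val σ x < val σ y → toℕ x < toℕ y
      position-< {x} {y} ¬yx vx<vy with <-cmp (toℕ x) (toℕ y)
      ... | tri< x<y _ _ = x<y
      ... | tri≈ _ x≡y _ = contradiction (cong (val σ) (toℕ-injective x≡y)) (<⇒≢ vx<vy)
      ... | tri> _ _ y<x with ordered y<x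
      ...   | inj₁ vy<vx = contradiction vx<vy (<⇒≯ vy<vx)
      ...   | inj₂ yx    = contradiction yx ¬yx

      value-< : ∀ {x y} → ¬ (NE x × SW y) → toℕ x < toℕ y → val σ x < val σ y
      value-< ¬xy x<y with ordered x<y
      ... | inj₁ vx<vy = vx<vy
      ... | inj₂ xy    = contradiction xy ¬xy

      val≤n : ∀ k → val σ k ≤ n
      val≤n k = <⇒≤ (toℕ<n (σ ⟨$⟩ʳ k))

      k≤n : ∀ (k : Fin n) → toℕ k ≤ n
      k≤n k = <⇒≤ (toℕ<n k)

    -- σ k is the number of positions with a smaller value. An entry in neither NE nor SW is part of
    -- no inversion, so these are exactly the positions before k.
    val-fixed : ∀ k → ¬ NE k → ¬ SW k → val σ k ≡ toℕ k
    val-fixed k ¬ne ¬sw = begin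
      val σ k                          ≡⟨ count-val σ (val≤n k) ⟨
      count (λ l → val σ l <? val σ k) ≡⟨ count-cong (λ l → val σ l <? val σ k) (below? n (toℕ k))
                                            (λ l → position-< (¬ne ∘ proj₁)) (λ l → value-< (¬sw ∘ proj₂)) ⟩
      count (below? n (toℕ k))         ≡⟨ count-below (k≤n k) ⟩
      toℕ k                            ∎
      where open ≡-Reasoning

    -- Smaller values stand at the positions before k and, besides, at all SW positions, which come
    -- after k. Dually in `val-SW`, the positions before k carry smaller values except for the NE
    -- ones.
    val-NE : ∀ k → NE k → val σ k ≡ toℕ k + count SW?
    val-NE k (k<i , j≤v) = begin
      val σ k                            ≡⟨ count-val σ (val≤n k) ⟨
      count (λ l → val σ l <? val σ k)   ≡⟨ count-⊎ (λ l → val σ l <? val σ k) (below? n (toℕ k)) SW?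
                                              split
                                              (λ l → value-< λ (_ , i≤k , _) → <⇒≱ k<i i≤k)
                                              (λ l (_ , vl<j) → <-≤-trans vl<j j≤v)
                                              (λ l l<k (i≤l , _) → <⇒≱ (<-trans l<k k<i) i≤l) ⟩
      count (below? n (toℕ k)) + count SW? ≡⟨ cong (_+ count SW?) (count-below (k≤n k)) ⟩
      toℕ k + count SW?                  ∎
      where
      open ≡-Reasoning
      split : ∀ l → val σ l < val σ k → toℕ l < toℕ k ⊎ SW l
      split l vl<vk with SW? l
      ... | yes sw = inj₂ sw
      ... | no ¬sw = inj₁ (position-< (¬sw ∘ proj₂) vl<vk)

    val-SW : ∀ k → SW k → val σ k + count NE? ≡ toℕ k
    val-SW k (i≤k , v<j) = sym $ begin
      toℕ k                            ≡⟨ count-below (k≤n k) ⟨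
      count (below? n (toℕ k))         ≡⟨ count-⊎ (below? n (toℕ k)) (λ l → val σ l <? val σ k) NE?
                                              split
                                              (λ l → position-< λ ((k<i , _) , _) → <⇒≱ k<i i≤k)
                                              (λ l (l<i , _) → <-≤-trans l<i i≤k)
                                              (λ l vl<vk (_ , j≤vl) → <⇒≱ (<-trans vl<vk v<j) j≤vl) ⟩
      count (λ l → val σ l <? val σ k) + count NE? ≡⟨ cong (_+ count NE?) (count-val σ (val≤n k)) ⟩
      val σ k + count NE?              ∎
      where
      open ≡-Reasoning
      split : ∀ l → toℕ l < toℕ k → val σ l < val σ k ⊎ NE l
      split l l<k with NE? l
      ... | yes ne = inj₂ ne
      ... | no ¬ne = inj₁ (value-< (¬ne ∘ proj₁) l<k)

    -- This and the next two bounds show that the quadrants occupy consecutive intervals of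
    -- positions in the order NW, NE, SW, SE. Here every position up to k is again NW.
    NW⇒< : ∀ k → NW k → toℕ k < count NW?
    NW⇒< k (k<i , v<j) = ≤-trans (≤-reflexive (sym (count-below (toℕ<n k))))
      (count-mono (below? n (suc (toℕ k))) NW? λ l l≤k → ≤-<-trans (s≤s⁻¹ l≤k) k<i ,
        (case m≤n⇒m<n∨m≡n (s≤s⁻¹ l≤k) of λ where
          (inj₁ l<k) → <-trans (value-< (λ (_ , i≤k , _) → <⇒≱ k<i i≤k) l<k) v<j
          (inj₂ l≡k) → subst (λ z → val σ z < j) (sym (toℕ-injective l≡k)) v<j))

    NE⇒≥ : ∀ k → NE k → count NW? ≤ toℕ k
    NE⇒≥ k (k<i , j≤v) = ≤-trans
      (count-mono NW? (below? n (toℕ k)) λ l (l<i , vl<j) →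
        position-< (λ (_ , i≤l , _) → <⇒≱ l<i i≤l) (<-≤-trans vl<j j≤v))
      (count-below≤ n (toℕ k))

    SE⇒≥ : i ≤ n → ∀ k → i ≤ toℕ k → j ≤ val σ k → i + count SW? ≤ toℕ k
    SE⇒≥ i≤n k i≤k j≤v = ≤-trans
      (≤-reflexive (cong (_+ count SW?) (sym (count-below i≤n)))) $ ≤-trans
      (count-disjoint (below? n (toℕ k)) (below? n i) SW?
        (λ l l<i → <-≤-trans l<i i≤k)
        (λ l (_ , vl<j) → position-< (λ ((k<i , _) , _) → <⇒≱ k<i i≤k) (<-≤-trans vl<j j≤v))
        (λ l l<i (i≤l , _) → <⇒≱ l<i i≤l))
      (count-below≤ n (toℕ k))

-- Effect of exchanging two entries

module _ (f g : Fin n → ℕ) (x y : Fin n) (x≢y : x ≢ y)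
         (f≡g : ∀ k → k ≢ x → k ≢ y → f k ≡ g k) where

  private
    at : Fin n → ℕ → Fin n → ℕ
    at z c k = if does (k Fin.≟ z) then c else 0

    ∑-at : ∀ z c → ∑ (at z c) ≡ c
    ∑-at z c = δ-∑ z (at z c) c
      (λ k k≢z → case-no k k≢z) case-yes
      where
      case-no : ∀ k → k ≢ z → at z c k ≡ 0
      case-no k k≢z with k Fin.≟ z
      ... | yes k≡z = contradiction k≡z k≢z
      ... | no _    = refl
      case-yes : at z c z ≡ c
      case-yes with z Fin.≟ z
      ... | yes _  = refl
      ... | no z≢z = contradiction refl z≢z

    pointwise : ∀ k → f k + (at x (g x) k + at y (g y) k) ≡ g k + (at x (f x) k + at y (f y) k)
    pointwise k with k Fin.≟ x | k Fin.≟ y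
    ... | yes refl | yes refl = contradiction refl x≢y
    ... | yes refl | no _     rewrite +-identityʳ (g x) | +-identityʳ (f x) = +-comm (f x) (g x)
    ... | no _     | yes refl = +-comm (f y) (g y)
    ... | no k≢x   | no k≢y   = cong (_+ 0) (f≡g k k≢x k≢y)

    ∑-+-at : ∀ (h : Fin n → ℕ) a b → ∑ (λ k → h k + (at x a k + at y b k)) ≡ ∑ h + (a + b)
    ∑-+-at h a b = trans (∑-distrib-+ h _)
      (cong (∑ h +_) (trans (∑-distrib-+ (at x a) _) (cong₂ _+_ (∑-at x a) (∑-at y b))))

  -- Adding to each function the other's values at x and y makes the two agree pointwise up to the
  -- order of summands; the additive form avoids subtraction in ℕ.
  ∑-differ-at-two : ∑ f + (g x + g y) ≡ ∑ g + (f x + f y)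
  ∑-differ-at-two = trans (sym (∑-+-at f _ _)) (trans (∑-cong pointwise) (∑-+-at g _ _))

module _ {x y : Fin n} (x<y : toℕ x < toℕ y) where

  private
    x≢y : x ≢ y
    x≢y refl = <-irrefl refl x<y

  transpose-left : transpose x y ⟨$⟩ʳ x ≡ y
  transpose-left with x Fin.≟ x
  ... | yes _  = refl
  ... | no x≢x = contradiction refl x≢x

  transpose-right : transpose x y ⟨$⟩ʳ y ≡ x
  transpose-right with y Fin.≟ x
  ... | yes y≡x = contradiction (sym y≡x) x≢y
  ... | no _ with y Fin.≟ y
  ...   | yes _  = refl
  ...   | no y≢y = contradiction refl y≢y

  transpose-other : ∀ k → k ≢ x → k ≢ y → transpose x y ⟨$⟩ʳ k ≡ k
  transpose-other k k≢x k≢y with k Fin.≟ x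
  ... | yes k≡x = contradiction k≡x k≢x
  ... | no _ with k Fin.≟ y
  ...   | yes k≡y = contradiction k≡y k≢y
  ...   | no _    = refl

  -- The weight f of a matrix cell is arbitrary because two weights are needed: the indicator of the
  -- NE quadrant for `rank`, and (n - k) v for `measure`.
  ∑-transpose : ∀ (σ : 𝔖 n) (f : Fin n → Fin n → ℕ) → let τ = transpose x y ∘ₚ σ in
    ∑ (λ k → f k (τ ⟨$⟩ʳ k)) + (f x (σ ⟨$⟩ʳ x) + f y (σ ⟨$⟩ʳ y)) ≡
    ∑ (λ k → f k (σ ⟨$⟩ʳ k)) + (f x (σ ⟨$⟩ʳ y) + f y (σ ⟨$⟩ʳ x))
  ∑-transpose σ f = trans
    (∑-differ-at-two _ _ x y x≢y
      (λ k k≢x k≢y → cong (f k ∘ (σ ⟨$⟩ʳ_)) (transpose-other k k≢x k≢y)))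
    (cong (∑ (λ k → f k (σ ⟨$⟩ʳ k)) +_)
      (cong₂ _+_ (cong (f x ∘ (σ ⟨$⟩ʳ_)) transpose-left) (cong (f y ∘ (σ ⟨$⟩ʳ_)) transpose-right)))

module _ {A B C D : Set} where

  -- For indicators a ≥ b and c ≥ d, the difference (a c + b d) - (a d + b c) is (a - b)(c - d),
  -- hence 0 or 1. In the application a, b say that x, y lie north of the cut and c, d that their
  -- values lie east of it. `swap-≥` adds that 1 occurs only for a = c = 1 and b = d = 0, a crossing
  -- pair.
  swap-≤ : (B → A) → (D → C) → (a : Dec A) (b : Dec B) (c : Dec C) (d : Dec D) →
           ⟦ a ×-dec d ⟧ + ⟦ b ×-dec c ⟧ ≤ ⟦ a ×-dec c ⟧ + ⟦ b ×-dec d ⟧ ×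
           ⟦ a ×-dec c ⟧ + ⟦ b ×-dec d ⟧ ≤ suc (⟦ a ×-dec d ⟧ + ⟦ b ×-dec c ⟧)
  swap-≤ B⇒A D⇒C (no ¬a) (yes b) _       _       = contradiction (B⇒A b) ¬a
  swap-≤ B⇒A D⇒C _       _       (no ¬c) (yes d) = contradiction (D⇒C d) ¬c
  swap-≤ B⇒A D⇒C (no _)  (no _)  _       _       = z≤n , z≤n
  swap-≤ B⇒A D⇒C (yes _) (yes _) (yes _) (yes _) = ≤-refl , n≤1+n _
  swap-≤ B⇒A D⇒C (yes _) (yes _) (yes _) (no _)  = ≤-refl , n≤1+n _
  swap-≤ B⇒A D⇒C (yes _) (no _)  (yes _) (yes _) = ≤-refl , n≤1+n _
  swap-≤ B⇒A D⇒C (yes _) (no _)  (yes _) (no _)  = z≤n , ≤-refl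
  swap-≤ B⇒A D⇒C (yes _) (yes _) (no _)  (no _)  = z≤n , z≤n
  swap-≤ B⇒A D⇒C (yes _) (no _)  (no _)  (no _)  = z≤n , z≤n

  swap-≥ : (B → A) → (D → C) → (a : Dec A) (b : Dec B) (c : Dec C) (d : Dec D) →
           ¬ ((A × C) × (¬ B × ¬ D)) →
           ⟦ a ×-dec c ⟧ + ⟦ b ×-dec d ⟧ ≤ ⟦ a ×-dec d ⟧ + ⟦ b ×-dec c ⟧
  swap-≥ B⇒A D⇒C (no ¬a) (yes b) _       _       h = contradiction (B⇒A b) ¬a
  swap-≥ B⇒A D⇒C _       _       (no ¬c) (yes d) h = contradiction (D⇒C d) ¬c
  swap-≥ B⇒A D⇒C (no _)  (no _)  _       _       h = z≤n
  swap-≥ B⇒A D⇒C (yes _) (yes _) (yes _) (yes _) h = ≤-refl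
  swap-≥ B⇒A D⇒C (yes _) (yes _) (yes _) (no _)  h = ≤-refl
  swap-≥ B⇒A D⇒C (yes _) (no _)  (yes _) (yes _) h = ≤-refl
  swap-≥ B⇒A D⇒C (yes a) (no ¬b) (yes c) (no ¬d) h = contradiction ((a , c) , ¬b , ¬d) h
  swap-≥ B⇒A D⇒C (yes _) (yes _) (no _)  (no _)  h = z≤n
  swap-≥ B⇒A D⇒C (yes _) (no _)  (no _)  (no _)  h = z≤n

module _ {a b c d : ℕ} (a+b≡c+d : a + b ≡ c + d) where

  exchange-≤ : d ≤ b → a ≤ c
  exchange-≤ d≤b = +-cancelʳ-≤ d a c (≤-trans (+-monoʳ-≤ a d≤b) (≤-reflexive a+b≡c+d))

module _ (σ : 𝔖 n) {x y} (x<y : toℕ x < toℕ y) (vy<vx : val σ y < val σ x) (i j : ℕ) where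

  private
    τ = transpose x y ∘ₚ σ

    cell : Fin n → Fin n → ℕ
    cell k v = ⟦ (toℕ k <? i) ×-dec (j ≤? toℕ v) ⟧

    ranks : rank τ i j + (cell x (σ ⟨$⟩ʳ x) + cell y (σ ⟨$⟩ʳ y)) ≡
            rank σ i j + (cell x (σ ⟨$⟩ʳ y) + cell y (σ ⟨$⟩ʳ x))
    ranks = ∑-transpose x<y σ cell

    bounds = swap-≤ (<-trans x<y) (λ j≤ → ≤-trans j≤ (<⇒≤ vy<vx))
                    (toℕ x <? i) (toℕ y <? i) (j ≤? val σ x) (j ≤? val σ y)

  rank-reduction-≤ : rank τ i j ≤ rank σ i j
  rank-reduction-≤ = exchange-≤ ranks (proj₁ bounds)

  rank-reduction-≥ : rank σ i j ≤ suc (rank τ i j)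
  rank-reduction-≥ = exchange-≤ {b = suc (cell x (σ ⟨$⟩ʳ y) + cell y (σ ⟨$⟩ʳ x))}
    (trans (+-suc _ _) (cong suc (sym ranks))) (proj₂ bounds)

  rank-reduction-≡ : ¬ (NE σ i j x × SW σ i j y) → rank σ i j ≤ rank τ i j
  rank-reduction-≡ ¬cross = exchange-≤ (sym ranks)
    (swap-≥ (<-trans x<y) (λ j≤ → ≤-trans j≤ (<⇒≤ vy<vx))
            (toℕ x <? i) (toℕ y <? i) (j ≤? val σ x) (j ≤? val σ y)
            (λ (ne , y≮i , j≰vy) → ¬cross (ne , ≮⇒≥ y≮i , ≰⇒> j≰vy)))

rank-cong : ∀ {π σ : 𝔖 n} → π ≈ σ → ∀ i j → rank π i j ≡ rank σ i j
rank-cong π≈σ i j = ∑-cong λ k → cong (λ v → ⟦ (toℕ k <? i) ×-dec (j ≤? toℕ v) ⟧) (π≈σ k)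

Star⇒rank-≤ : ∀ {σ τ : 𝔖 n} → Star Reduction σ τ → ∀ i j → rank τ i j ≤ rank σ i j
Star⇒rank-≤ ε i j = ≤-refl
Star⇒rank-≤ {σ = σ} (reduce x<y vy<vx ◅ steps) i j =
  ≤-trans (Star⇒rank-≤ steps i j) (rank-reduction-≤ σ x<y vy<vx i j)

≤ᴮ⇒rank-≤ : ∀ {π σ : 𝔖 n} → π ≤ᴮ σ → ∀ i j → rank π i j ≤ rank σ i j
≤ᴮ⇒rank-≤ {π = π} (τ , steps , τ≈π) i j =
  ≤-trans (≤-reflexive (sym (rank-cong {π = τ} {π} τ≈π i j))) (Star⇒rank-≤ steps i j)

-- Reductions decrease this by the rearrangement inequality.
measure : 𝔖 n → ℕ
measure {n} σ = ∑ (λ k → (n ∸ toℕ k) * val σ k)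

rearrangement : ∀ {a b u v} → a < b → u < v → b * u + a * v < b * v + a * u
rearrangement {a} {u = u} {v} a<b u<v with d , refl ← m≤n⇒∃[o]m+o≡n a<b = begin-strict
  (suc a + d) * u + a * v           ≡⟨ lemma a d u v ⟩
  suc d * u + (a * u + a * v)       <⟨ +-monoˡ-< (a * u + a * v) (*-monoʳ-< (suc d) u<v) ⟩
  suc d * v + (a * u + a * v)       ≡⟨ cong (suc d * v +_) (+-comm (a * u) (a * v)) ⟩
  suc d * v + (a * v + a * u)       ≡⟨ lemma a d v u ⟨
  (suc a + d) * v + a * u           ∎
  where
  open ≤-Reasoning
  lemma : ∀ a d u v → (suc a + d) * u + a * v ≡ suc d * u + (a * u + a * v)
  lemma = solve-∀

measure-reduction : ∀ (σ : 𝔖 n) {x y} → toℕ x < toℕ y → val σ y < val σ x →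
                    measure (transpose x y ∘ₚ σ) < measure σ
measure-reduction {n} σ {x} {y} x<y vy<vx = +-cancelʳ-< _ _ _ $ begin-strict
  measure (transpose x y ∘ₚ σ) + ((n ∸ toℕ x) * val σ y + (n ∸ toℕ y) * val σ x)
    <⟨ +-monoʳ-< (measure (transpose x y ∘ₚ σ))
         (rearrangement (∸-monoʳ-< x<y (<⇒≤ (toℕ<n y))) vy<vx) ⟩
  measure (transpose x y ∘ₚ σ) + ((n ∸ toℕ x) * val σ x + (n ∸ toℕ y) * val σ y)
    ≡⟨ ∑-transpose x<y σ (λ k v → (n ∸ toℕ k) * toℕ v) ⟩
  measure σ + ((n ∸ toℕ x) * val σ y + (n ∸ toℕ y) * val σ x) ∎
  where open ≤-Reasoning

module _ {i j r : ℕ} (i≤n : i ≤ n) (j≤n : j ≤ n) (0<r : 0 < r) (i<j+r : i < j + r) where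

  private
    descend-acc : ∀ (σ : 𝔖 n) → Acc _<_ (measure σ) → r ≤ rank σ i j →
                  ∃ λ ω → Star Reduction σ ω × Crossing ω i j × rank ω i j ≡ r
    descend-acc σ (acc rs) r≤rank
      with any? (λ x → any? λ y → (toℕ x <? toℕ y) ×-dec (val σ y <? val σ x)
                             ×-dec (r ≤? rank (transpose x y ∘ₚ σ) i j))
    ... | yes (x , y , x<y , vy<vx , r≤) =
      let ω , steps , rest = descend-acc _ (rs (measure-reduction σ x<y vy<vx)) r≤
      in  ω , reduce x<y vy<vx ◅ steps , rest
    ... | no minimal = σ , ε , crossing , ≤-antisym (≮⇒≥ r≮rank) r≤rank
      where
      -- A non-crossing inversion could be exchanged without loss of rank, against minimality.
      crossing : Crossing σ i j
      crossing {x} {y} x<y vy<vx with NE? σ i j x ×-dec SW? σ i j y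
      ... | yes c = c
      ... | no ¬c = contradiction
        (x , y , x<y , vy<vx , ≤-trans r≤rank (rank-reduction-≡ σ x<y vy<vx i j ¬c)) minimal

      -- NW + NE = i and NW + SW = j give SW = NE + j - i, which is positive once NE ≥ r, since i <
      -- j + r.
      0<SW : r < rank σ i j → 0 < count (SW? σ i j)
      0<SW r<rank = +-cancelʳ-< (rank σ i j) _ _ $ +-cancelˡ-< (count (NW? σ i j)) _ _ $ begin-strict
        count (NW? σ i j) + rank σ i j                        ≡⟨ NW+NE σ i j i≤n ⟩
        i                                                     <⟨ i<j+r ⟩
        j + r                                                 ≤⟨ +-monoʳ-≤ j (<⇒≤ r<rank) ⟩
        j + rank σ i j                                        ≡⟨ cong (_+ rank σ i j) (NW+SW σ i j j≤n) ⟨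
        count (NW? σ i j) + count (SW? σ i j) + rank σ i j    ≡⟨ +-assoc (count (NW? σ i j)) _ _ ⟩
        count (NW? σ i j) + (count (SW? σ i j) + rank σ i j)  ∎
        where open ≤-Reasoning

      -- Any NE entry forms an inversion with any SW entry. Exchanging them lowers the rank by at
      -- most one, so it would still be at least r.
      r≮rank : ¬ r < rank σ i j
      r≮rank r<rank
        with x , x<i , j≤vx ← count>0⇒∃ (NE? σ i j) (<-trans 0<r r<rank)
           | y , i≤y , vy<j ← count>0⇒∃ (SW? σ i j) (0<SW r<rank)
        = minimal (x , y , x<y , vy<vx , s≤s⁻¹ (≤-trans r<rank (rank-reduction-≥ σ x<y vy<vx i j)))
        where
        x<y = <-≤-trans x<i i≤y
        vy<vx = <-≤-trans vy<j j≤vx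

  descend : ∀ (σ : 𝔖 n) → r ≤ rank σ i j →
            ∃ λ ω → Star Reduction σ ω × Crossing ω i j × rank ω i j ≡ r
  descend σ = descend-acc σ (<-wellFounded _)

-- The Bruhat order on bigrassmannian permutations

∸-≤⇒≤-+ : ∀ m n {o} → m ∸ n ≤ o → m ≤ n + o
∸-≤⇒≤-+ m n m∸n≤o = ≤-trans (m≤n+m∸n m n) (+-monoʳ-≤ n m∸n≤o)

-- Stated through inversions and a rank, not through values, so that the outcome of `descend` has a
-- shape at once; `val-shape` recovers the one-line notation.
record Shape (σ : 𝔖 n) (p q r s : ℕ) : Set where
  field
    total    : p + r + q + s ≡ n
    0<q      : 0 < q
    0<r      : 0 < r
    crossing : Crossing σ (p + r) (p + q)
    rank≡r   : rank σ (p + r) (p + q) ≡ r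

  p+r+q≤n : p + r + q ≤ n
  p+r+q≤n = ≤-trans (m≤m+n _ s) (≤-reflexive total)

  i≤n : p + r ≤ n
  i≤n = ≤-trans (m≤m+n _ q) p+r+q≤n

  j≤n : p + q ≤ n
  j≤n = ≤-trans (+-monoˡ-≤ q (m≤m+n p r)) p+r+q≤n

  NW≡p : count (NW? σ (p + r) (p + q)) ≡ p
  NW≡p = +-cancelʳ-≡ _ _ _
    (trans (NW+NE σ (p + r) (p + q) i≤n) (cong (p +_) (sym rank≡r)))

  SW≡q : count (SW? σ (p + r) (p + q)) ≡ q
  SW≡q = +-cancelˡ-≡ p _ _
    (trans (cong (_+ count (SW? σ (p + r) (p + q))) (sym NW≡p)) (NW+SW σ (p + r) (p + q) j≤n))

-- The one-line notation 1⋯a (b+1)⋯c (a+1)⋯b (c+1)⋯n with a = p, b = p + q, c = p + q + r.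
blockVal : ℕ → ℕ → ℕ → ℕ → ℕ
blockVal p q r k with k <? p | k <? p + r | k <? p + r + q
... | yes _ | _     | _     = k
... | no _  | yes _ | _     = k + q
... | no _  | no _  | yes _ = k ∸ r
... | no _  | no _  | no _  = k

module _ {σ : 𝔖 n} {p q r s} (shape : Shape σ p q r s) where

  open Shape shape

  private
    i = p + r
    j = p + q

  -- The position of k determines its quadrant as far as its value depends on it: `NE⇒≥`, `NW⇒<` and
  -- `SE⇒≥` place it in the first three blocks, and past p + r + q an SW entry would have value at
  -- least j by `val-SW`.
  val-shape : ∀ k → val σ k ≡ blockVal p q r (toℕ k)
  val-shape k with toℕ k <? p | toℕ k <? p + r | toℕ k <? p + r + q
  ... | yes k<p | _ | _ = val-fixed σ i j crossing k
        (λ ne → <⇒≱ k<p (≤-trans (≤-reflexive (sym NW≡p)) (NE⇒≥ σ i j crossing k ne)))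
        (λ (i≤k , _) → <⇒≱ (<-≤-trans k<p (m≤m+n p r)) i≤k)
  ... | no k≮p | yes k<i | _ = trans
        (val-NE σ i j crossing k
          (k<i , ≮⇒≥ λ v<j → k≮p (<-≤-trans (NW⇒< σ i j crossing k (k<i , v<j)) (≤-reflexive NW≡p))))
        (cong (toℕ k +_) SW≡q)
  ... | no _ | no k≮i | yes k<c = begin
          val σ k             ≡⟨ m+n∸n≡m (val σ k) r ⟨
          val σ k + r ∸ r     ≡⟨ cong (λ z → val σ k + z ∸ r) rank≡r ⟨
          val σ k + rank σ i j ∸ r ≡⟨ cong (_∸ r) (val-SW σ i j crossing k sw) ⟩
          toℕ k ∸ r           ∎
        where
        open ≡-Reasoning
        sw : SW σ i j k
        sw = ≮⇒≥ k≮i , ≰⇒> λ j≤v → <⇒≱ k<c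
          (≤-trans (≤-reflexive (cong (i +_) (sym SW≡q))) (SE⇒≥ σ i j crossing i≤n k (≮⇒≥ k≮i) j≤v))
  ... | no _ | no k≮i | no k≮c = val-fixed σ i j crossing k
        (λ (k<i , _) → k≮i k<i)
        (λ sw → k≮c (begin-strict
          toℕ k                 ≡⟨ val-SW σ i j crossing k sw ⟨
          val σ k + rank σ i j  ≡⟨ cong (val σ k +_) rank≡r ⟩
          val σ k + r           <⟨ +-monoˡ-< r (proj₂ sw) ⟩
          p + q + r             ≡⟨ lemma p q r ⟩
          p + r + q             ∎))
        where
        open ≤-Reasoning
        lemma : ∀ p q r → p + q + r ≡ p + r + q
        lemma = solve-∀

Shape-unique : ∀ {σ τ : 𝔖 n} {p q r s} → Shape σ p q r s → Shape τ p q r s → σ ≈ τ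
Shape-unique a b k = toℕ-injective (trans (val-shape a k) (sym (val-shape b k)))

Shape-resp-≈ : ∀ {σ τ : 𝔖 n} {p q r s} → σ ≈ τ → Shape σ p q r s → Shape τ p q r s
Shape-resp-≈ {σ = σ} {τ} {p} {q} {r} σ≈τ a = record
  { total = total ; 0<q = 0<q ; 0<r = 0<r
  ; crossing = λ {x} {y} x<y vy<vx →
      let v : ∀ k → val σ k ≡ val τ k
          v k = cong toℕ (σ≈τ k)
          (x<i , j≤vx) , (i≤y , vy<j) = crossing x<y (subst₂ _<_ (sym (v y)) (sym (v x)) vy<vx)
      in  (x<i , subst (p + q ≤_) (v x) j≤vx) , (i≤y , subst (_< p + q) (v y) vy<j)
  ; rank≡r = trans (sym (rank-cong {π = σ} {τ} σ≈τ (p + r) (p + q))) rank≡r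
  }
  where open Shape a

data Block (p q r k v : ℕ) : Set where
  fixed : v ≡ k → Block p q r k v
  up    : p ≤ k → k < p + r → v ≡ k + q → Block p q r k v
  down  : p + r ≤ k → k < p + r + q → v + r ≡ k → Block p q r k v

block : ∀ p q r k → Block p q r k (blockVal p q r k)
block p q r k with k <? p | k <? p + r | k <? p + r + q
... | yes _  | _       | _      = fixed refl
... | no k≮p | yes k<i | _      = up (≮⇒≥ k≮p) k<i refl
... | no _   | no k≮i  | yes k< = down (≮⇒≥ k≮i) k< (m∸n+n≡m (≤-trans (m≤n+m r p) (≮⇒≥ k≮i)))
... | no _   | no _    | no _   = fixed refl

module _ (a b : ℕ) {c d : ℕ} (a+c≡b+d : a + c ≡ b + d) where

  complement-≤ : d ≤ c → a ≤ b
  complement-≤ d≤c = +-cancelʳ-≤ c a b (≤-trans (≤-reflexive a+c≡b+d) (+-monoʳ-≤ b d≤c))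

  complement-≥ : a ≤ b → d ≤ c
  complement-≥ a≤b = +-cancelˡ-≤ a d c (≤-trans (+-monoˡ-≤ d a≤b) (≤-reflexive (sym a+c≡b+d)))

Below : (p q r s p′ q′ r′ s′ : ℕ) → Set
Below p q r s p′ q′ r′ s′ = (p′ ≤ p × s′ ≤ s) × (q ≤ q′ × r ≤ r′)

module _ {ω τ : 𝔖 n} {p q r s p′ q′ r′ s′ : ℕ}
         (a : Shape ω p q r s) (b : Shape τ p′ q′ r′ s′) where

  private
    module A = Shape a
    module B = Shape b
    i = p + r
    j = p + q

    totals : p + r + q + s ≡ p′ + r′ + q′ + s′
    totals = trans A.total (sym B.total)

  Below⇒rank-≥ : Below p q r s p′ q′ r′ s′ → r ≤ rank τ i j
  Below⇒rank-≥ ((p′≤p , s′≤s) , (q≤q′ , r≤r′)) =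
    count-interval-≥ (NE? τ i j) t (≤-trans t+r≤i A.i≤n) inside
    where
    -- The r positions from t on are NE for τ. They start inside its raised block, late enough for
    -- the raised value k + q′ to reach j; they end before i because t ≤ p, and within the raised
    -- block because of the bounds on s′ and r′.
    t = p′ ⊔ (j ∸ q′)

    t≤p : t ≤ p
    t≤p = ⊔-lub p′≤p (m≤n+o⇒m∸n≤o j q′ (≤-trans (+-monoʳ-≤ p q≤q′) (≤-reflexive (+-comm p q′))))

    t+r≤i : t + r ≤ i
    t+r≤i = +-monoˡ-≤ r t≤p

    t+r≤p′+r′ : t + r ≤ p′ + r′
    t+r≤p′+r′ = ≤-trans (≤-reflexive (+-distribʳ-⊔ r p′ (j ∸ q′)))
      (⊔-lub (+-monoʳ-≤ p′ r≤r′) shifted)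
      where
      open ≤-Reasoning
      shifted : j ∸ q′ + r ≤ p′ + r′
      shifted with ≤-total j q′
      ... | inj₁ j≤q′ = begin
        j ∸ q′ + r ≡⟨ cong (_+ r) (m≤n⇒m∸n≡0 j≤q′) ⟩
        r          ≤⟨ r≤r′ ⟩
        r′         ≤⟨ m≤n+m r′ p′ ⟩
        p′ + r′    ∎
      ... | inj₂ q′≤j = +-cancelʳ-≤ q′ _ _ (begin
        j ∸ q′ + r + q′   ≡⟨ lemma (j ∸ q′) r q′ ⟩
        j ∸ q′ + q′ + r   ≡⟨ cong (_+ r) (m∸n+n≡m q′≤j) ⟩
        p + q + r         ≡⟨ lemma p q r ⟩
        p + r + q         ≤⟨ complement-≤ (p + r + q) (p′ + r′ + q′) totals s′≤s ⟩
        p′ + r′ + q′      ∎)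
        where
        lemma : ∀ x y z → x + y + z ≡ x + z + y
        lemma = solve-∀

    inside : ∀ k → t ≤ toℕ k → toℕ k < t + r → NE τ i j k
    inside k t≤k k<t+r = <-≤-trans k<t+r t+r≤i , j≤v
      where
      open ≤-Reasoning
      p′≤k = ≤-trans (m≤m⊔n p′ (j ∸ q′)) t≤k
      k<p′+r′ = <-≤-trans k<t+r t+r≤p′+r′
      blockVal≡ : blockVal p′ q′ r′ (toℕ k) ≡ toℕ k + q′
      blockVal≡ with toℕ k <? p′ | toℕ k <? p′ + r′
      ... | yes k<p′ | _       = contradiction p′≤k (<⇒≱ k<p′)
      ... | no _     | yes _   = refl
      ... | no _     | no k≮   = contradiction k<p′+r′ k≮
      j≤v : j ≤ val τ k
      j≤v = begin
        j               ≤⟨ ∸-≤⇒≤-+ j q′ (≤-trans (m≤n⊔m p′ (j ∸ q′)) t≤k) ⟩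
        q′ + toℕ k      ≡⟨ +-comm q′ (toℕ k) ⟩
        toℕ k + q′      ≡⟨ blockVal≡ ⟨
        blockVal p′ q′ r′ (toℕ k) ≡⟨ val-shape b k ⟨
        val τ k         ∎

  private
    blockτ : ∀ k → Block p′ q′ r′ (toℕ k) (val τ k)
    blockτ k rewrite val-shape b k = block p′ q′ r′ (toℕ k)

    comm₃ : ∀ x y z → x + y + z ≡ x + z + y
    comm₃ = solve-∀

  -- For i ≤ j every NE position of τ lies in its raised block; for j ≤ i every SW position lies
  -- in its lowered block, and there are at least q of these since NE + j = SW + i.
  rank-≥⇒Below : r ≤ rank τ i j → Below p q r s p′ q′ r′ s′
  rank-≥⇒Below r≤R with ≤-total i j
  ... | inj₁ i≤j = (p′≤p , s′≤s) , (q≤q′ , r≤r′)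
    where
    up′ : ∀ k → NE τ i j k → p′ ≤ toℕ k × toℕ k < p′ + r′ × val τ k ≡ toℕ k + q′
    up′ k (k<i , j≤v) with blockτ k
    ... | fixed v≡k      = contradiction (≤-trans i≤j (≤-trans j≤v (≤-reflexive v≡k))) (<⇒≱ k<i)
    ... | up p′≤k k< v≡  = p′≤k , k< , v≡
    ... | down _ _ v+r≡k = contradiction
      (≤-trans i≤j (≤-trans j≤v (≤-trans (m≤m+n _ r′) (≤-reflexive v+r≡k)))) (<⇒≱ k<i)

    -- At least r positions in [l, u) force l + r ≤ u. Combining the lower bounds p′ and j - q′ with
    -- the upper bounds i and p′ + r′ gives the four inequalities.
    interval : ∀ {l u} → l ≤ n → (∀ k → NE τ i j k → l ≤ toℕ k × toℕ k < u) → l + r ≤ u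
    interval {l} l≤n f = ≤-trans (+-monoʳ-≤ l r≤R)
      (count-interval-≤ (NE? τ i j) l≤n (<-≤-trans A.0<r r≤R) f)

    p′≤n : p′ ≤ n
    p′≤n = ≤-trans (m≤m+n p′ r′) B.i≤n

    j∸q′≤n : j ∸ q′ ≤ n
    j∸q′≤n = ≤-trans (m∸n≤m j q′) A.j≤n

    j∸q′≤k : ∀ k → NE τ i j k → j ∸ q′ ≤ toℕ k
    j∸q′≤k k ne = m≤n+o⇒m∸n≤o j q′
      (≤-trans (proj₂ ne) (≤-reflexive (trans (proj₂ (proj₂ (up′ k ne))) (+-comm _ q′))))

    p′≤p : p′ ≤ p
    p′≤p = +-cancelʳ-≤ r p′ p (interval p′≤n λ k ne → proj₁ (up′ k ne) , proj₁ ne)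

    r≤r′ : r ≤ r′
    r≤r′ = +-cancelˡ-≤ p′ r r′ (interval p′≤n λ k ne → proj₁ (up′ k ne) , proj₁ (proj₂ (up′ k ne)))

    q≤q′ : q ≤ q′
    q≤q′ = +-cancelˡ-≤ p q q′ (≤-trans
      (∸-≤⇒≤-+ j q′ (+-cancelʳ-≤ r _ p (interval j∸q′≤n λ k ne → j∸q′≤k k ne , proj₁ ne)))
      (≤-reflexive (+-comm q′ p)))

    s′≤s : s′ ≤ s
    s′≤s = complement-≥ (p + r + q) (p′ + r′ + q′) totals (begin
      p + r + q             ≡⟨ comm₃ p r q ⟩
      j + r                 ≤⟨ +-monoˡ-≤ r (m≤n+m∸n j q′) ⟩
      q′ + (j ∸ q′) + r     ≡⟨ +-assoc q′ _ r ⟩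
      q′ + (j ∸ q′ + r)     ≤⟨ +-monoʳ-≤ q′ (interval j∸q′≤n λ k ne → j∸q′≤k k ne , proj₁ (proj₂ (up′ k ne))) ⟩
      q′ + (p′ + r′)        ≡⟨ +-comm q′ _ ⟩
      p′ + r′ + q′          ∎)
      where open ≤-Reasoning
  ... | inj₂ j≤i = (p′≤p , s′≤s) , (q≤q′ , r≤r′)
    where
    down′ : ∀ k → SW τ i j k → p′ + r′ ≤ toℕ k × toℕ k < p′ + r′ + q′ × val τ k + r′ ≡ toℕ k
    down′ k (i≤k , v<j) with blockτ k
    ... | fixed v≡k      = contradiction (≤-trans j≤i (≤-trans i≤k (≤-reflexive (sym v≡k)))) (<⇒≱ v<j)
    ... | up _ _ v≡      = contradiction
      (≤-trans j≤i (≤-trans i≤k (≤-trans (m≤m+n _ q′) (≤-reflexive (sym v≡))))) (<⇒≱ v<j)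
    ... | down i′≤k k< v = i′≤k , k< , v

    q≤SW : q ≤ count (SW? τ i j)
    q≤SW = +-cancelˡ-≤ i _ _ (begin
      p + r + q                                             ≡⟨ comm₃ p r q ⟩
      j + r                                                 ≤⟨ +-monoʳ-≤ j r≤R ⟩
      j + rank τ i j                                        ≡⟨ cong (_+ rank τ i j) (NW+SW τ i j A.j≤n) ⟨
      count (NW? τ i j) + count (SW? τ i j) + rank τ i j    ≡⟨ comm₃ (count (NW? τ i j)) _ _ ⟩
      count (NW? τ i j) + rank τ i j + count (SW? τ i j)    ≡⟨ cong (_+ count (SW? τ i j)) (NW+NE τ i j A.i≤n) ⟩
      i + count (SW? τ i j)                                 ∎)
      where open ≤-Reasoning

    -- Now q positions are available; the lower bounds are i and p′ + r′, the upper bounds p′ + r′ +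
    -- q′ and j + r′.
    interval : ∀ {l u} → l ≤ n → (∀ k → SW τ i j k → l ≤ toℕ k × toℕ k < u) → l + q ≤ u
    interval {l} l≤n f = ≤-trans (+-monoʳ-≤ l q≤SW)
      (count-interval-≤ (SW? τ i j) l≤n (<-≤-trans A.0<q q≤SW) f)

    k<j+r′ : ∀ k → SW τ i j k → toℕ k < j + r′
    k<j+r′ k sw = ≤-<-trans (≤-reflexive (sym (proj₂ (proj₂ (down′ k sw))))) (+-monoˡ-< r′ (proj₂ sw))

    s′≤s : s′ ≤ s
    s′≤s = complement-≥ (p + r + q) (p′ + r′ + q′) totals (interval A.i≤n λ k sw → proj₁ sw , proj₁ (proj₂ (down′ k sw)))

    r≤r′ : r ≤ r′
    r≤r′ = +-cancelˡ-≤ j r r′ (≤-trans (≤-reflexive (comm₃ p q r))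
      (interval A.i≤n λ k sw → proj₁ sw , k<j+r′ k sw))

    q≤q′ : q ≤ q′
    q≤q′ = +-cancelˡ-≤ (p′ + r′) q q′
      (interval B.i≤n λ k sw → proj₁ (down′ k sw) , proj₁ (proj₂ (down′ k sw)))

    p′≤p : p′ ≤ p
    p′≤p = +-cancelʳ-≤ (r′ + q) p′ p (begin
      p′ + (r′ + q)  ≡⟨ +-assoc p′ r′ q ⟨
      p′ + r′ + q    ≤⟨ interval B.i≤n (λ k sw → proj₁ (down′ k sw) , k<j+r′ k sw) ⟩
      p + q + r′     ≡⟨ comm₃ p q r′ ⟩
      p + r′ + q     ≡⟨ +-assoc p r′ q ⟩
      p + (r′ + q)   ∎)
      where open ≤-Reasoning

module _ {p q r s : ℕ} (total : p + r + q + s ≡ n) (0<q : 0 < q) (0<r : 0 < r) where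

  private
    i≤n : p + r ≤ n
    i≤n = ≤-trans (m≤m+n _ q) (≤-trans (m≤m+n _ s) (≤-reflexive total))

    j+r≤n : p + q + r ≤ n
    j+r≤n = ≤-trans (≤-reflexive (lemma p q r)) (≤-trans (m≤m+n _ s) (≤-reflexive total))
      where
      lemma : ∀ p q r → p + q + r ≡ p + r + q
      lemma = solve-∀

    i<j+r : p + r < p + q + r
    i<j+r = +-monoˡ-< r (m<m+n p 0<q)

  shape-below : ∀ (σ : 𝔖 n) → r ≤ rank σ (p + r) (p + q) → ∃ λ ω → Shape ω p q r s × ω ≤ᴮ σ
  shape-below σ r≤rank =
    let ω , steps , crossing , rank≡r = descend i≤n (≤-trans (m≤m+n _ r) j+r≤n) 0<r i<j+r σ r≤rank
    in  ω , record { total = total ; 0<q = 0<q ; 0<r = 0<r ; crossing = crossing ; rank≡r = rank≡r }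
          , ω , steps , λ _ → refl

  -- Descend from the longest permutation: its first r entries are at least n - r, hence at least p
  -- + q, so its rank at the cut is large enough.
  shape-exists : ∃ λ (ω : 𝔖 n) → Shape ω p q r s
  shape-exists =
    let ω , shape , _ = shape-below reverse (count-interval-≥ (NE? reverse (p + r) (p + q)) 0
                          (≤-trans (m≤n+m r p) i≤n)
                          λ k _ k<r → <-≤-trans k<r (m≤n+m r p) , (begin
                            p + q              ≤⟨ m+n≤o⇒m≤o∸n (p + q) (≤-trans (+-monoʳ-≤ (p + q) k<r) j+r≤n) ⟩
                            n ∸ suc (toℕ k)    ≡⟨ opposite-prop k ⟨
                            val reverse k      ∎))
    in  ω , shape
    where open ≤-Reasoning

module _ {ω τ : 𝔖 n} {p q r s p′ q′ r′ s′ : ℕ}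
         (a : Shape ω p q r s) (b : Shape τ p′ q′ r′ s′) where

  Below⇒≤ᴮ : Below p q r s p′ q′ r′ s′ → ω ≤ᴮ τ
  Below⇒≤ᴮ h =
    let open Shape a
        ρ , shape , (υ , steps , υ≈ρ) = shape-below {s = s} total 0<q 0<r τ (Below⇒rank-≥ a b h)
    in  υ , steps , λ k → trans (υ≈ρ k) (Shape-unique shape a k)

  ≤ᴮ⇒Below : ω ≤ᴮ τ → Below p q r s p′ q′ r′ s′
  ≤ᴮ⇒Below ω≤τ = rank-≥⇒Below a b
    (≤-trans (≤-reflexive (sym (Shape.rank≡r a))) (≤ᴮ⇒rank-≤ {π = ω} {τ} ω≤τ (p + r) (p + q)))

-- Bigrassmannian permutations and their block lengths

module _ (ω : 𝔖 n) where

  -- If the step from x to x + 1 is not a descent, then x + 1 and y still form an inversion, one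
  -- position closer.
  inversion⇒descent : ∀ {x y} → toℕ x < toℕ y → val ω y < val ω x →
                      ∃ λ d → Descent ω d × toℕ x ≤ toℕ d × toℕ d < toℕ y
  inversion⇒descent {x} {y} x<y vy<vx with m , x+m≡y ← m≤n⇒∃[o]m+o≡n x<y = go m x (sym x+m≡y) vy<vx
    where
    go : ∀ m x → toℕ y ≡ suc (toℕ x) + m → val ω y < val ω x →
         ∃ λ d → Descent ω d × toℕ x ≤ toℕ d × toℕ d < toℕ y
    go zero x y≡ vy<vx = x , (y , trans y≡ (+-identityʳ _) , vy<vx) , ≤-refl ,
      ≤-reflexive (sym (trans y≡ (+-identityʳ _)))
    go (suc m) x y≡ vy<vx with val ω x⁺ <? val ω x
      where
      x⁺<n : suc (toℕ x) < n
      x⁺<n = ≤-<-trans (≤-trans (m≤m+n _ (suc m)) (≤-reflexive (sym y≡))) (toℕ<n y)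
      x⁺ : Fin n
      x⁺ = fromℕ< x⁺<n
    ... | yes vx⁺<vx = x , (_ , toℕ-fromℕ< _ , vx⁺<vx) , ≤-refl ,
      ≤-trans (m≤m+n _ (suc m)) (≤-reflexive (sym y≡))
    ... | no vx⁺≮vx =
      let d , descent , x⁺≤d , d<y = go m _
            (trans y≡ (trans (+-suc _ m) (cong (λ z → suc z + m) (sym (toℕ-fromℕ< _)))))
            (<-≤-trans vy<vx (≮⇒≥ vx⁺≮vx))
      in  d , descent , ≤-trans (n≤1+n _) (≤-trans (≤-reflexive (sym (toℕ-fromℕ< _))) x⁺≤d) , d<y

  -- A descent is an inversion of adjacent positions; if it straddles i, its right position is i.
  straddle⇒OneDescent : ∀ {i} →
    (∀ {x y} → toℕ x < toℕ y → val ω y < val ω x → toℕ x < i × i ≤ toℕ y) →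
    ∀ {x y} → toℕ x < toℕ y → val ω y < val ω x → OneDescent ω
  straddle⇒OneDescent {i} straddle x<y vy<vx =
    let d , descent , _ = inversion⇒descent x<y vy<vx
    in  d , descent , λ descent′ →
          toℕ-injective (suc-injective (trans (position descent) (sym (position descent′))))
    where
    position : ∀ {d} → Descent ω d → suc (toℕ d) ≡ i
    position {d} (e , e≡1+d , ve<vd) =
      let d<i , i≤e = straddle (≤-reflexive (sym e≡1+d)) ve<vd
      in  ≤-antisym d<i (≤-trans i≤e (≤-reflexive e≡1+d))

  OneDescent⇒straddle : (one : OneDescent ω) →
    ∀ {x y} → toℕ x < toℕ y → val ω y < val ω x →
    toℕ x < suc (toℕ (proj₁ one)) × suc (toℕ (proj₁ one)) ≤ toℕ y
  OneDescent⇒straddle (d , _ , unique) x<y vy<vx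
    with d′ , descent′ , x≤d′ , d′<y ← inversion⇒descent x<y vy<vx
    with refl ← unique descent′ = s≤s x≤d′ , d′<y

-- Inversions of the inverse are those of ω with positions and values exchanged, so they straddle p
-- + q where those of ω straddle p + r. An NE and an SW entry exist because r and q are positive,
-- and they form an inversion.
Shape⇒Bigrassmannian : ∀ {ω : 𝔖 n} {p q r s} → Shape ω p q r s → Bigrassmannian ω
Shape⇒Bigrassmannian {n} {ω} {p} {q} {r} shape
  with x , x<i , j≤vx ← count>0⇒∃ (NE? ω (p + r) (p + q)) (subst (0 <_) (sym (Shape.rank≡r shape)) (Shape.0<r shape))
     | y , i≤y , vy<j ← count>0⇒∃ (SW? ω (p + r) (p + q)) (subst (0 <_) (sym (Shape.SW≡q shape)) (Shape.0<q shape))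
  = straddle⇒OneDescent ω
      (λ x<y vy<vx → let (x<i , _) , (i≤y , _) = crossing x<y vy<vx in x<i , i≤y) x<y vy<vx
  , straddle⇒OneDescent (flip ω) flip-straddle vy<vx
      (subst₂ _<_ (cong toℕ (sym (inverseˡ ω))) (cong toℕ (sym (inverseˡ ω))) x<y)
  where
  open Shape shape
  x<y = <-≤-trans x<i i≤y
  vy<vx = <-≤-trans vy<j j≤vx
  flip-straddle : ∀ {u v} → toℕ u < toℕ v → val (flip ω) v < val (flip ω) u →
                  toℕ u < p + q × p + q ≤ toℕ v
  flip-straddle {u} {v} u<v fv<fu =
    let (_ , j≤v) , (_ , u<j) = crossing fv<fu (subst₂ _<_ (cong toℕ (sym (inverseʳ ω))) (cong toℕ (sym (inverseʳ ω))) u<v)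
    in  subst (_< p + q) (cong toℕ (inverseʳ ω)) u<j , subst (p + q ≤_) (cong toℕ (inverseʳ ω)) j≤v

Crossing⇒Shape : ∀ (ω : 𝔖 n) {i j} → i ≤ n → j ≤ n → Crossing ω i j →
                 ∃ (NE ω i j) → ∃ (SW ω i j) →
                 ∃[ p ] ∃[ q ] ∃[ r ] ∃[ s ] Shape ω p q r s
Crossing⇒Shape {n} ω {i} {j} i≤n j≤n crossing (x , ne) (y , sw) = p , q , r , n ∸ (p + r + q) , record
  { total = m+[n∸m]≡n p+r+q≤n
  ; 0<q = ∃⇒count>0 (SW? ω i j) y sw
  ; 0<r = ∃⇒count>0 (NE? ω i j) x ne
  ; crossing = subst₂ (λ i j → Crossing ω i j) (sym p+r≡i) (sym p+q≡j) crossing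
  ; rank≡r = cong₂ (rank ω) p+r≡i p+q≡j
  }
  where
  p = count (NW? ω i j)
  q = count (SW? ω i j)
  r = rank ω i j
  p+r≡i = NW+NE ω i j i≤n
  p+q≡j = NW+SW ω i j j≤n
  p+r+q≤n : p + r + q ≤ n
  p+r+q≤n = begin
    p + r + q                 ≡⟨ cong (_+ q) (trans p+r≡i (sym (count-below i≤n))) ⟩
    count (below? n i) + q    ≤⟨ count-disjoint (below? n n) (below? n i) (SW? ω i j)
                                   (λ k _ → toℕ<n k) (λ k _ → toℕ<n k) (λ k k<i (i≤k , _) → <⇒≱ k<i i≤k) ⟩
    count (below? n n)        ≤⟨ count-below≤ n n ⟩
    n                         ∎
    where open ≤-Reasoning

-- The cut lies just after the descent d of ω and the descent c of its inverse: an inversion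
-- straddles the first by its positions and the second by its values.
Bigrassmannian⇒Shape : ∀ (ω : 𝔖 n) → Bigrassmannian ω →
                       ∃[ p ] ∃[ q ] ∃[ r ] ∃[ s ] Shape ω p q r s
Bigrassmannian⇒Shape {n} ω (one@(d , (e , e≡1+d , ve<vd) , _) , one′@(c , _)) =
  Crossing⇒Shape ω (toℕ<n d) (toℕ<n c) crossing (d , proj₁ top) (e , proj₂ top)
  where
  crossing : Crossing ω (suc (toℕ d)) (suc (toℕ c))
  crossing {x} {y} x<y vy<vx =
    let x<i , i≤y = OneDescent⇒straddle ω one x<y vy<vx
        vy<j , j≤vx = OneDescent⇒straddle (flip ω) one′ vy<vx
                        (subst₂ _<_ (cong toℕ (sym (inverseˡ ω))) (cong toℕ (sym (inverseˡ ω))) x<y)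
    in  (x<i , j≤vx) , (i≤y , vy<j)
  top = crossing (≤-reflexive (sym e≡1+d)) ve<vd

-- Enumeration by quadruples

concatMap-unique : ∀ {xs : List X} {f : X → List Y} → Unique xs → (∀ x → Unique (f x)) →
                   (∀ {x y z} → x ∈ xs → y ∈ xs → z ∈ f x → z ∈ f y → x ≡ y) →
                   Unique (concatMap f xs)
concatMap-unique {xs = []}     []           uf inj = []
concatMap-unique {xs = x ∷ xs} {f} (x∉xs ∷ uxs) uf inj = Unique.++⁺ (uf x)
  (concatMap-unique uxs uf (λ x∈ y∈ → inj (there x∈) (there y∈)))
  λ (z∈fx , z∈rest) → case find (∈-concatMap⁻ f z∈rest) of λ where
    (y , y∈xs , z∈fy) → All.lookup x∉xs y∈xs (inj (here refl) (there y∈xs) z∈fx z∈fy)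

antidiagonal : ℕ → List (ℕ × ℕ)
antidiagonal zero    = (0 , 0) ∷ []
antidiagonal (suc m) = (0 , suc m) ∷ map (map₁ suc) (antidiagonal m)

∈-antidiagonal⁺ : ∀ a b → (a , b) ∈ antidiagonal (a + b)
∈-antidiagonal⁺ zero    zero    = here refl
∈-antidiagonal⁺ zero    (suc b) = here refl
∈-antidiagonal⁺ (suc a) b       = there (∈-map⁺ (map₁ suc) (∈-antidiagonal⁺ a b))

∈-antidiagonal⁻ : ∀ m {a b} → (a , b) ∈ antidiagonal m → a + b ≡ m
∈-antidiagonal⁻ zero    (here refl) = refl
∈-antidiagonal⁻ (suc m) (here refl) = refl
∈-antidiagonal⁻ (suc m) (there ab∈) with (a , b) , ab∈′ , refl ← ∈-map⁻ (map₁ suc) ab∈ =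
  cong suc (∈-antidiagonal⁻ m ab∈′)

antidiagonal-unique : ∀ m → Unique (antidiagonal m)
antidiagonal-unique zero    = [] ∷ []
antidiagonal-unique (suc m) =
  All.map⁺ (All.tabulate λ _ ()) ∷ Unique.map⁺ (λ { refl → refl }) (antidiagonal-unique m)

-- ((p , s) , (q , r)) stands for the bigrassmannian permutation whose four blocks have
-- lengths p, r + 1, q + 1, s; the inner blocks are nonempty.
Quad : Set
Quad = (ℕ × ℕ) × (ℕ × ℕ)

size : Quad → ℕ
size ((p , s) , (q , r)) = p + s + (q + r)

HasShape : 𝔖 n → Quad → Set
HasShape ω ((p , s) , (q , r)) = Shape ω p (suc q) (suc r) s

quads : ℕ → List Quad
quads m = concatMap (λ (t , u) → cartesianProduct (antidiagonal t) (antidiagonal u)) (antidiagonal m)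

quads-unique : ∀ m → Unique (quads m)
quads-unique m = concatMap-unique (antidiagonal-unique m)
  (λ (t , u) → Unique.cartesianProduct⁺ (antidiagonal-unique t) (antidiagonal-unique u))
  λ {(t , u)} {(t′ , u′)} _ _ z∈ z∈′ →
    let a , b = ∈-cartesianProduct⁻ (antidiagonal t) (antidiagonal u) z∈
        a′ , b′ = ∈-cartesianProduct⁻ (antidiagonal t′) (antidiagonal u′) z∈′
    in  cong₂ _,_ (trans (sym (∈-antidiagonal⁻ t a)) (∈-antidiagonal⁻ t′ a′))
                  (trans (sym (∈-antidiagonal⁻ u b)) (∈-antidiagonal⁻ u′ b′))

∈-quads⁺ : ∀ x → x ∈ quads (size x)
∈-quads⁺ ((p , s) , (q , r)) = ∈-concatMap⁺ _ (lose (∈-antidiagonal⁺ (p + s) (q + r))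
  (∈-cartesianProduct⁺ (∈-antidiagonal⁺ p s) (∈-antidiagonal⁺ q r)))

∈-quads⁻ : ∀ m {x} → x ∈ quads m → size x ≡ m
∈-quads⁻ m {x} x∈ with (t , u) , tu∈ , x∈′ ← find (∈-concatMap⁻ _ {xs = antidiagonal m} x∈)
  with ps∈ , qr∈ ← ∈-cartesianProduct⁻ (antidiagonal t) (antidiagonal u) x∈′ =
  trans (cong₂ _+_ (∈-antidiagonal⁻ t ps∈) (∈-antidiagonal⁻ u qr∈)) (∈-antidiagonal⁻ m tu∈)

-- The order on quadruples and its up-sets

infix 4 _⊑_

-- The outer pair decreases while the inner pair increases, so `swap` turns this relation into its
-- converse. Hence the down-set counted by β is the up-set of the swapped quadruple.
_⊑_ : Quad → Quad → Set
((p , s) , (q , r)) ⊑ ((p′ , s′) , (q′ , r′)) = (p′ ≤ p × s′ ≤ s) × (q ≤ q′ × r ≤ r′)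

-- The size is constant: the lengths u and v taken from the outer blocks are redistributed as a + b
-- = u + v over the inner ones.
upset : Quad → List Quad
upset ((p , s) , (q , r)) = concatMap
  (λ ((p′ , u) , (s′ , v)) → map (λ (a , b) → (p′ , s′) , (q + a , r + b)) (antidiagonal (u + v)))
  (cartesianProduct (antidiagonal p) (antidiagonal s))

upset-unique : ∀ x → Unique (upset x)
upset-unique ((p , s) , (q , r)) = concatMap-unique
  (Unique.cartesianProduct⁺ (antidiagonal-unique p) (antidiagonal-unique s))
  (λ ((p′ , u) , (s′ , v)) → Unique.map⁺
    (λ eq → cong₂ _,_ (+-cancelˡ-≡ q _ _ (,-injectiveˡ (,-injectiveʳ eq)))
                      (+-cancelˡ-≡ r _ _ (,-injectiveʳ (,-injectiveʳ eq))))
    (antidiagonal-unique (u + v)))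
  disjoint
  where
  disjoint : ∀ {x y z} → x ∈ cartesianProduct (antidiagonal p) (antidiagonal s) →
             y ∈ cartesianProduct (antidiagonal p) (antidiagonal s) →
             z ∈ map (λ (a , b) → (proj₁ (proj₁ x) , proj₁ (proj₂ x)) , (q + a , r + b))
                   (antidiagonal (proj₂ (proj₁ x) + proj₂ (proj₂ x))) →
             z ∈ map (λ (a , b) → (proj₁ (proj₁ y) , proj₁ (proj₂ y)) , (q + a , r + b))
                   (antidiagonal (proj₂ (proj₁ y) + proj₂ (proj₂ y))) →
             x ≡ y
  disjoint {(p′ , u) , (s′ , v)} {(p″ , u′) , (s″ , v′)} x∈ y∈ z∈ z∈′
    with _ , _ , z≡ ← ∈-map⁻ _ z∈ | _ , _ , z≡′ ← ∈-map⁻ _ z∈′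
    with refl ← ,-injectiveˡ (trans (sym z≡) z≡′)
    with pu , sv ← ∈-cartesianProduct⁻ (antidiagonal p) (antidiagonal s) x∈
       | pu′ , sv′ ← ∈-cartesianProduct⁻ (antidiagonal p) (antidiagonal s) y∈
    = cong₂ (λ u v → (p′ , u) , (s′ , v))
        (+-cancelˡ-≡ p′ u u′ (trans (∈-antidiagonal⁻ p pu) (sym (∈-antidiagonal⁻ p pu′))))
        (+-cancelˡ-≡ s′ v v′ (trans (∈-antidiagonal⁻ s sv) (sym (∈-antidiagonal⁻ s sv′))))

private
  size-above : ∀ p s a b q r → p + s + (q + a + (r + b)) ≡ p + s + (q + r) + (a + b)
  size-above = solve-∀

  size-below : ∀ p s u v q r → p + u + (s + v) + (q + r) ≡ p + s + (q + r) + (u + v)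
  size-below = solve-∀

∈-upset⁻ : ∀ x {y} → y ∈ upset x → x ⊑ y × size y ≡ size x
∈-upset⁻ ((p , s) , (q , r)) y∈
  with ((p′ , u) , (s′ , v)) , w∈ , y∈′ ← find (∈-concatMap⁻ _ {xs = cartesianProduct (antidiagonal p) (antidiagonal s)} y∈)
  with (a , b) , ab∈ , refl ← ∈-map⁻ _ y∈′
  with pu , sv ← ∈-cartesianProduct⁻ (antidiagonal p) (antidiagonal s) w∈
  with refl ← ∈-antidiagonal⁻ p pu | refl ← ∈-antidiagonal⁻ s sv
  = ((m≤m+n p′ u , m≤m+n s′ v) , (m≤m+n q a , m≤m+n r b))
  , trans (size-above p′ s′ a b q r)
      (trans (cong (p′ + s′ + (q + r) +_) (∈-antidiagonal⁻ (u + v) ab∈))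
             (sym (size-below p′ s′ u v q r)))

∈-upset⁺ : ∀ x {y} → x ⊑ y → size y ≡ size x → y ∈ upset x
∈-upset⁺ ((p , s) , (q , r)) {((p′ , s′) , (q′ , r′))} ((p′≤p , s′≤s) , (q≤q′ , r≤r′)) eq
  with u , refl ← m≤n⇒∃[o]m+o≡n p′≤p | v , refl ← m≤n⇒∃[o]m+o≡n s′≤s
     | a , refl ← m≤n⇒∃[o]m+o≡n q≤q′ | b , refl ← m≤n⇒∃[o]m+o≡n r≤r′
  = ∈-concatMap⁺ _ (lose (∈-cartesianProduct⁺ (∈-antidiagonal⁺ p′ u) (∈-antidiagonal⁺ s′ v))
      (∈-map⁺ _ (subst (λ z → (a , b) ∈ antidiagonal z) a+b≡u+v (∈-antidiagonal⁺ a b))))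
  where
  a+b≡u+v : a + b ≡ u + v
  a+b≡u+v = +-cancelˡ-≡ (p′ + s′ + (q + r)) _ _
    (trans (sym (size-above p′ s′ a b q r)) (trans eq (size-below p′ s′ u v q r)))

dummy : Quad
dummy = (0 , 0) , (0 , 0)

Bigrassmannian⇒HasShape : ∀ (ω : 𝔖 n) → Bigrassmannian ω → ∃ (HasShape ω)
Bigrassmannian⇒HasShape ω b with Bigrassmannian⇒Shape ω b
... | p , suc q , suc r , s , shape = ((p , s) , (q , r)) , shape
... | p , zero  , _     , s , shape = contradiction (Shape.0<q shape) λ ()
... | p , suc _ , zero  , s , shape = contradiction (Shape.0<r shape) λ ()

quad : 𝔖 n → Quad
quad ω with bigrassmannian? ω
... | yes b = proj₁ (Bigrassmannian⇒HasShape ω b)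
-- A default that makes `quad` total; `quad` is only ever mapped over lists of bigrassmannian
-- permutations.
... | no _  = dummy

quad-HasShape : ∀ (ω : 𝔖 n) → Bigrassmannian ω → HasShape ω (quad ω)
quad-HasShape ω b with bigrassmannian? ω
... | yes b′ = proj₂ (Bigrassmannian⇒HasShape ω b′)
... | no ¬b  = contradiction b ¬b

⊑-antisym : ∀ {x y} → x ⊑ y → y ⊑ x → x ≡ y
⊑-antisym ((a , b) , (c , d)) ((a′ , b′) , (c′ , d′)) =
  cong₂ _,_ (cong₂ _,_ (≤-antisym a′ a) (≤-antisym b′ b)) (cong₂ _,_ (≤-antisym c c′) (≤-antisym d d′))

module _ {ω τ : 𝔖 n} {x y : Quad} (a : HasShape ω x) (b : HasShape τ y) where

  ⊑⇒≤ᴮ : x ⊑ y → ω ≤ᴮ τ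
  ⊑⇒≤ᴮ (ps , (q≤q′ , r≤r′)) = Below⇒≤ᴮ a b (ps , (s≤s q≤q′ , s≤s r≤r′))

  ≤ᴮ⇒⊑ : ω ≤ᴮ τ → x ⊑ y
  ≤ᴮ⇒⊑ ω≤τ = let ps , (q≤q′ , r≤r′) = ≤ᴮ⇒Below a b ω≤τ in ps , (s≤s⁻¹ q≤q′ , s≤s⁻¹ r≤r′)

≤ᴮ-refl : ∀ {ω : 𝔖 n} → ω ≤ᴮ ω
≤ᴮ-refl {ω = ω} = ω , ε , λ _ → refl

-- Comparing ω with itself in the Bruhat order relates x and y both ways.
HasShape-injective : ∀ {ω : 𝔖 n} {x y} → HasShape ω x → HasShape ω y → x ≡ y
HasShape-injective {ω = ω} a b = ⊑-antisym (≤ᴮ⇒⊑ a b (≤ᴮ-refl {ω = ω})) (≤ᴮ⇒⊑ b a (≤ᴮ-refl {ω = ω}))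

size-HasShape : ∀ {ω : 𝔖 n} x → HasShape ω x → 2 + size x ≡ n
size-HasShape ((p , s) , (q , r)) shape = trans (lemma p q r s) (Shape.total shape)
  where
  lemma : ∀ p q r s → 2 + (p + s + (q + r)) ≡ p + suc r + suc q + s
  lemma = solve-∀

HasShape-exists : ∀ x → 2 + size x ≡ n → ∃ λ (ω : 𝔖 n) → HasShape ω x
HasShape-exists ((p , s) , (q , r)) eq = shape-exists (trans (lemma p q r s) eq) (s≤s z≤n) (s≤s z≤n)
  where
  lemma : ∀ p q r s → p + suc r + suc q + s ≡ 2 + (p + s + (q + r))
  lemma = solve-∀

∈-𝔅⁻ : ∀ {ω : 𝔖 n} → ω ∈ 𝔅 n → Bigrassmannian ω
∈-𝔅⁻ {n} ω∈ = proj₂ (∈-filter⁻ bigrassmannian? {xs = permutations n} ω∈)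

𝔅-complete : ∀ x → 2 + size x ≡ n → ∃ λ (ω : 𝔖 n) → ω ∈ 𝔅 n × HasShape ω x
𝔅-complete {n} x eq =
  let π , shape = HasShape-exists x eq
      ω , ω∈ , π≈ω = find (permutations-enumeration n π)
      shape′ = Shape-resp-≈ π≈ω shape
  in  ω , ∈-filter⁺ bigrassmannian? ω∈ (Shape⇒Bigrassmannian shape′) , shape′

-- Permutations with equal block lengths are pointwise equal, so uniqueness up to `_≈_` becomes
-- propositional uniqueness of quadruples.
map-quad-unique : ∀ {ωs : List (𝔖 n)} → (∀ {ω} → ω ∈ ωs → Bigrassmannian ω) →
                  Uniqueₛ (𝔖-setoid n) ωs → Unique (map quad ωs)
map-quad-unique {ωs = []}     big []           = []
map-quad-unique {ωs = ω ∷ ωs} big (ω∉ωs ∷ uωs) =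
  All.map⁺ (All.tabulate λ {τ} τ∈ eq → All.lookup ω∉ωs τ∈
    (Shape-unique (quad-HasShape ω (big (here refl)))
                  (subst (HasShape τ) (sym eq) (quad-HasShape τ (big (there τ∈))))))
  ∷ map-quad-unique (big ∘ there) uωs

module _ {Q : Pred (𝔖 n) 0ℓ} (Q? : Decidable Q) {L : List Quad} (L-unique : Unique L)
         (Q⇒L : ∀ {τ y} → HasShape τ y → Q τ → y ∈ L)
         (L⇒Q : ∀ {y} → y ∈ L → 2 + size y ≡ n × (∀ {τ} → HasShape τ y → Q τ)) where

  -- Both lists are free of repetitions and have the same members. It serves for all of `𝔅 n`, for
  -- the elements above ω and for those below it.
  map-quad-filter : map quad (filter Q? (𝔅 n)) ↭ L
  map-quad-filter = ∼bag⇒↭ (unique∧set⇒bag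
    (map-quad-unique (∈-𝔅⁻ ∘ proj₁ ∘ ∈-filter⁻ Q? {xs = 𝔅 n})
      (Uniqueₛ.filter⁺ (𝔖-setoid n) Q?
        (Uniqueₛ.filter⁺ (𝔖-setoid n) bigrassmannian? (permutations-unique n))))
    L-unique (mk⇔ to from))
    where
    to : ∀ {y} → y ∈ map quad (filter Q? (𝔅 n)) → y ∈ L
    to y∈ with τ , τ∈ , refl ← ∈-map⁻ quad y∈
      with τ∈𝔅 , Qτ ← ∈-filter⁻ Q? {xs = 𝔅 n} τ∈ = Q⇒L (quad-HasShape τ (∈-𝔅⁻ τ∈𝔅)) Qτ

    from : ∀ {y} → y ∈ L → y ∈ map quad (filter Q? (𝔅 n))
    from {y} y∈ =
      let eq , q = L⇒Q y∈
          τ , τ∈𝔅 , shape = 𝔅-complete y eq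
      in  subst (_∈ map quad (filter Q? (𝔅 n)))
            (HasShape-injective (quad-HasShape τ (∈-𝔅⁻ τ∈𝔅)) shape)
            (∈-map⁺ quad (∈-filter⁺ Q? τ∈𝔅 (q shape)))

  length-filter-𝔅 : length (filter Q? (𝔅 n)) ≡ length L
  length-filter-𝔅 = trans (sym (length-map quad (filter Q? (𝔅 n)))) (↭.↭-length map-quad-filter)

map-quad-𝔅 : ∀ {m n} → 2 + m ≡ n → map quad (𝔅 n) ↭ quads m
map-quad-𝔅 {m} {n} 2+m≡n = subst (λ ωs → map quad ωs ↭ quads m)
  (filter-all bigrassmannian? {xs = 𝔅 n} (All.tabulate ∈-𝔅⁻))
  (map-quad-filter bigrassmannian? (quads-unique m)
    (λ {τ} {y} shape _ → subst (λ z → y ∈ quads z)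
      (+-cancelˡ-≡ 2 _ _ (trans (size-HasShape y shape) (sym 2+m≡n))) (∈-quads⁺ y))
    (λ y∈ → trans (cong (2 +_) (∈-quads⁻ m y∈)) 2+m≡n , Shape⇒Bigrassmannian))

α-length : ∀ {ω : 𝔖 n} {x} → HasShape ω x → α ω ≡ length (upset x)
α-length {ω = ω} {x} shape = length-filter-𝔅 (λ τ → ω ≤ᴮ? τ) (upset-unique x)
  (λ {τ} {y} shape′ ω≤τ → ∈-upset⁺ x (≤ᴮ⇒⊑ shape shape′ ω≤τ)
    (+-cancelˡ-≡ 2 _ _ (trans (size-HasShape y shape′) (sym (size-HasShape x shape)))))
  (λ y∈ → let x⊑y , eq = ∈-upset⁻ x y∈
          in  trans (cong (2 +_) eq) (size-HasShape x shape) , λ shape′ → ⊑⇒≤ᴮ shape shape′ x⊑y)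

size-swap : ∀ x → size (swap x) ≡ size x
size-swap ((p , s) , (q , r)) = +-comm (q + r) (p + s)

β-length : ∀ {ω : 𝔖 n} {x} → HasShape ω x → β ω ≡ length (upset (swap x))
β-length {n} {ω} {x} shape = trans
  (length-filter-𝔅 (λ π → π ≤ᴮ? ω) (Unique.map⁺ swap-injective (upset-unique (swap x)))
    (λ {τ} {y} shape′ τ≤ω → ∈-map⁺ swap (∈-upset⁺ (swap x) (swap (≤ᴮ⇒⊑ shape′ shape τ≤ω))
      (+-cancelˡ-≡ 2 _ _ (begin
        2 + size (swap y) ≡⟨ cong (2 +_) (size-swap y) ⟩
        2 + size y        ≡⟨ size-HasShape y shape′ ⟩
        n                 ≡⟨ size-HasShape x shape ⟨
        2 + size x        ≡⟨ cong (2 +_) (size-swap x) ⟨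
        2 + size (swap x) ∎))))
    L⇒Q)
  (length-map swap (upset (swap x)))
  where
  open ≡-Reasoning
  swap-injective : ∀ {x y : Quad} → swap x ≡ swap y → x ≡ y
  swap-injective refl = refl
  L⇒Q : ∀ {y} → y ∈ map swap (upset (swap x)) → 2 + size y ≡ n × (∀ {τ} → HasShape τ y → τ ≤ᴮ ω)
  L⇒Q y∈ with z , z∈ , refl ← ∈-map⁻ swap y∈ =
    let x⊑z , eq = ∈-upset⁻ (swap x) z∈
    in  trans (cong (2 +_) (trans (size-swap z) (trans eq (size-swap x)))) (size-HasShape x shape)
      , λ shape′ → ⊑⇒≤ᴮ shape′ shape (swap x⊑z)

-- Sums over 𝔅 n as convolutions

sum-map-++ : ∀ (f : X → ℕ) xs ys → sum (map f (xs ++ ys)) ≡ sum (map f xs) + sum (map f ys)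
sum-map-++ f xs ys = trans (cong sum (map-++ f xs ys)) (sum-++ (map f xs) (map f ys))

length-as-sum : ∀ (xs : List X) → length xs ≡ sum (map (λ _ → 1) xs)
length-as-sum []       = refl
length-as-sum (_ ∷ xs) = cong suc (length-as-sum xs)

length-concatMap : ∀ (f : X → List Y) xs → length (concatMap f xs) ≡ sum (map (length ∘ f) xs)
length-concatMap f []       = refl
length-concatMap f (x ∷ xs) =
  trans (length-++ (f x)) (cong (length (f x) +_) (length-concatMap f xs))

sum-concatMap : ∀ (F : Y → ℕ) (f : X → List Y) xs →
                sum (map F (concatMap f xs)) ≡ sum (map (λ x → sum (map F (f x))) xs)
sum-concatMap F f []       = refl
sum-concatMap F f (x ∷ xs) =
  trans (sum-map-++ F (f x) _) (cong (sum (map F (f x)) +_) (sum-concatMap F f xs))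

sum-cartesianProduct : ∀ (F : X × Y → ℕ) xs ys → sum (map F (cartesianProduct xs ys)) ≡
                       sum (map (λ x → sum (map (λ y → F (x , y)) ys)) xs)
sum-cartesianProduct F []       ys = refl
sum-cartesianProduct F (x ∷ xs) ys = trans (sum-map-++ F (map (x ,_) ys) _)
  (cong₂ _+_ (cong sum (sym (map-∘ ys))) (sum-cartesianProduct F xs ys))

sum-*ˡ : ∀ c (f : X → ℕ) xs → sum (map (λ x → c * f x) xs) ≡ c * sum (map f xs)
sum-*ˡ c f []       = sym (*-zeroʳ c)
sum-*ˡ c f (x ∷ xs) = trans (cong (c * f x +_) (sum-*ˡ c f xs)) (sym (*-distribˡ-+ c (f x) _))

sum-product : ∀ (f : X → ℕ) (g : Y → ℕ) xs ys →
              sum (map (λ (x , y) → f x * g y) (cartesianProduct xs ys)) ≡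
              sum (map f xs) * sum (map g ys)
sum-product f g xs ys = begin
  sum (map (λ (x , y) → f x * g y) (cartesianProduct xs ys)) ≡⟨ sum-cartesianProduct _ xs ys ⟩
  sum (map (λ x → sum (map (λ y → f x * g y) ys)) xs)        ≡⟨ cong sum (map-cong (λ x →
                                                                  trans (sum-*ˡ (f x) g ys) (*-comm (f x) _)) xs) ⟩
  sum (map (λ x → sum (map g ys) * f x) xs)                  ≡⟨ sum-*ˡ (sum (map g ys)) f xs ⟩
  sum (map g ys) * sum (map f xs)                            ≡⟨ *-comm (sum (map g ys)) _ ⟩
  sum (map f xs) * sum (map g ys)                            ∎
  where open ≡-Reasoning

sum-antidiagonal-suc : ∀ (F : ℕ × ℕ → ℕ) m → sum (map F (antidiagonal (suc m))) ≡
                       F (0 , suc m) + sum (map (F ∘ map₁ suc) (antidiagonal m))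
sum-antidiagonal-suc F m = cong (F (0 , suc m) +_) (cong sum (sym (map-∘ (antidiagonal m))))

length-antidiagonal : ∀ m → length (antidiagonal m) ≡ suc m
length-antidiagonal zero    = refl
length-antidiagonal (suc m) = cong suc (trans (length-map _ (antidiagonal m)) (length-antidiagonal m))

row : ℕ → ℕ → ℕ
row s u = sum (map (λ (_ , v) → suc (u + v)) (antidiagonal s))

pyramid : ℕ × ℕ → ℕ
pyramid (p , s) = sum (map (λ (_ , u) → row s u) (antidiagonal p))

-- Only what is taken from the outer blocks matters: u + v units are redistributed in u + v + 1
-- ways, for each u ≤ p and v ≤ s.
length-upset : ∀ x → length (upset x) ≡ pyramid (proj₁ x)
length-upset ((p , s) , (q , r)) = begin
  length (upset ((p , s) , (q , r)))
    ≡⟨ length-concatMap _ (cartesianProduct (antidiagonal p) (antidiagonal s)) ⟩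
  sum (map _ (cartesianProduct (antidiagonal p) (antidiagonal s)))
    ≡⟨ cong sum (map-cong (λ ((_ , u) , (_ , v)) →
         trans (length-map _ (antidiagonal (u + v))) (length-antidiagonal (u + v)))
         (cartesianProduct (antidiagonal p) (antidiagonal s))) ⟩
  sum (map (λ ((_ , u) , (_ , v)) → suc (u + v)) (cartesianProduct (antidiagonal p) (antidiagonal s)))
    ≡⟨ sum-cartesianProduct (λ ((_ , u) , (_ , v)) → suc (u + v)) (antidiagonal p) (antidiagonal s) ⟩
  pyramid (p , s) ∎
  where open ≡-Reasoning

row-formula : ∀ u s → 2 * row s u ≡ suc s * (2 + u + u + s)
row-formula u zero    = base u
  where
  base : ∀ u → 2 * (suc (u + 0) + 0) ≡ 1 * (2 + u + u + 0)
  base = solve-∀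
row-formula u (suc s) = begin
  2 * row (suc s) u
    ≡⟨ cong (2 *_) (sum-antidiagonal-suc (λ (_ , v) → suc (u + v)) s) ⟩
  2 * (suc (u + suc s) + row s u)
    ≡⟨ *-distribˡ-+ 2 (suc (u + suc s)) _ ⟩
  2 * suc (u + suc s) + 2 * row s u
    ≡⟨ cong (2 * suc (u + suc s) +_) (row-formula u s) ⟩
  2 * suc (u + suc s) + suc s * (2 + u + u + s)
    ≡⟨ step u s ⟩
  suc (suc s) * (2 + u + u + suc s) ∎
  where
  open ≡-Reasoning
  step : ∀ u s → 2 * suc (u + suc s) + suc s * (2 + u + u + s) ≡ suc (suc s) * (2 + u + u + suc s)
  step = solve-∀

pyramid-formula : ∀ p s → 2 * pyramid (p , s) ≡ suc p * suc s * (2 + (p + s))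
pyramid-formula zero    s = trans (cong (2 *_) (+-identityʳ (row s 0))) (trans (row-formula 0 s) (base s))
  where
  base : ∀ s → suc s * (2 + 0 + 0 + s) ≡ 1 * suc s * (2 + (0 + s))
  base = solve-∀
pyramid-formula (suc p) s = begin
  2 * pyramid (suc p , s)
    ≡⟨ cong (2 *_) (sum-antidiagonal-suc (λ (_ , u) → row s u) p) ⟩
  2 * (row s (suc p) + pyramid (p , s))
    ≡⟨ *-distribˡ-+ 2 (row s (suc p)) _ ⟩
  2 * row s (suc p) + 2 * pyramid (p , s)
    ≡⟨ cong₂ _+_ (row-formula (suc p) s) (pyramid-formula p s) ⟩
  suc s * (2 + suc p + suc p + s) + suc p * suc s * (2 + (p + s))
    ≡⟨ step p s ⟩
  suc (suc p) * suc s * (2 + (suc p + s)) ∎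
  where
  open ≡-Reasoning
  step : ∀ p s → suc s * (2 + suc p + suc p + s) + suc p * suc s * (2 + (p + s)) ≡
                 suc (suc p) * suc s * (2 + (suc p + s))
  step = solve-∀

^-distribʳ-* : ∀ k m n → (m * n) ^ k ≡ m ^ k * n ^ k
^-distribʳ-* zero    m n = refl
^-distribʳ-* (suc k) m n =
  trans (cong (m * n *_) (^-distribʳ-* k m n)) ([m*n]*[o*p]≡[m*o]*[n*p] m n (m ^ k) (n ^ k))

conv : (ℕ → ℕ) → (ℕ → ℕ) → ℕ → ℕ
conv f g m = sum (map (λ (a , b) → f a * g b) (antidiagonal m))

power-sum : ℕ → ℕ → ℕ
power-sum k t = sum (map (λ ps → pyramid ps ^ k) (antidiagonal t))

-- On p + s = t the factor p + s + 2 of the pyramid number is constant and leaves the sum. The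
-- factor 2 ^ k clears the halves.
power-sum-formula : ∀ k t → 2 ^ k * power-sum k t ≡ (2 + t) ^ k * conv (λ a → suc a ^ k) (λ b → suc b ^ k) t
power-sum-formula k t = begin
  2 ^ k * sum (map (λ ps → pyramid ps ^ k) (antidiagonal t))
    ≡⟨ sum-*ˡ (2 ^ k) _ (antidiagonal t) ⟨
  sum (map (λ ps → 2 ^ k * pyramid ps ^ k) (antidiagonal t))
    ≡⟨ cong sum (map-cong-local (All.tabulate summand)) ⟩
  sum (map (λ (a , b) → (2 + t) ^ k * (suc a ^ k * suc b ^ k)) (antidiagonal t))
    ≡⟨ sum-*ˡ ((2 + t) ^ k) _ (antidiagonal t) ⟩
  (2 + t) ^ k * conv (λ a → suc a ^ k) (λ b → suc b ^ k) t ∎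
  where
  open ≡-Reasoning
  summand : ∀ {ab} → ab ∈ antidiagonal t →
            2 ^ k * pyramid ab ^ k ≡ (2 + t) ^ k * (suc (proj₁ ab) ^ k * suc (proj₂ ab) ^ k)
  summand {a , b} ab∈ = begin
    2 ^ k * pyramid (a , b) ^ k               ≡⟨ ^-distribʳ-* k 2 _ ⟨
    (2 * pyramid (a , b)) ^ k                 ≡⟨ cong (_^ k) (pyramid-formula a b) ⟩
    (suc a * suc b * (2 + (a + b))) ^ k       ≡⟨ cong (λ z → (suc a * suc b * (2 + z)) ^ k) (∈-antidiagonal⁻ t ab∈) ⟩
    (suc a * suc b * (2 + t)) ^ k             ≡⟨ ^-distribʳ-* k (suc a * suc b) _ ⟩
    (suc a * suc b) ^ k * (2 + t) ^ k         ≡⟨ *-comm ((suc a * suc b) ^ k) _ ⟩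
    (2 + t) ^ k * (suc a * suc b) ^ k         ≡⟨ cong ((2 + t) ^ k *_) (^-distribʳ-* k (suc a) (suc b)) ⟩
    (2 + t) ^ k * (suc a ^ k * suc b ^ k)     ∎

-- α depends on the outer pair and β on the inner pair only, so the sum over quadruples with p + s
-- and q + r fixed is a product. The shift by 2 accounts for the two nonempty inner blocks.
sum-𝔅 : ∀ {m n} k ℓ → 2 + m ≡ n → sum (map (λ ω → α ω ^ k * β ω ^ ℓ) (𝔅 n)) ≡ conv (power-sum k) (power-sum ℓ) m
sum-𝔅 {m} {n} k ℓ 2+m≡n = begin
  sum (map (λ ω → α ω ^ k * β ω ^ ℓ) (𝔅 n))
    ≡⟨ cong sum (map-cong-local {xs = 𝔅 n} (All.tabulate λ {ω} → value ω)) ⟩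
  sum (map (F ∘ quad) (𝔅 n))
    ≡⟨ cong sum (map-∘ (𝔅 n)) ⟩
  sum (map F (map quad (𝔅 n)))
    ≡⟨ sum-↭ (↭.map⁺ F (map-quad-𝔅 2+m≡n)) ⟩
  sum (map F (quads m))
    ≡⟨ sum-concatMap F _ (antidiagonal m) ⟩
  sum (map (λ (t , u) → sum (map F (cartesianProduct (antidiagonal t) (antidiagonal u)))) (antidiagonal m))
    ≡⟨ cong sum (map-cong (λ (t , u) →
         sum-product (λ ps → pyramid ps ^ k) (λ qr → pyramid qr ^ ℓ) (antidiagonal t) (antidiagonal u))
         (antidiagonal m)) ⟩
  conv (power-sum k) (power-sum ℓ) m ∎
  where
  open ≡-Reasoning
  F : Quad → ℕ
  F (ps , qr) = pyramid ps ^ k * pyramid qr ^ ℓ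

  value : ∀ ω → ω ∈ 𝔅 n → α ω ^ k * β ω ^ ℓ ≡ F (quad ω)
  value ω ω∈ = cong₂ (λ a b → a ^ k * b ^ ℓ)
    (trans (α-length {ω = ω} {quad ω} shape) (length-upset (quad ω)))
    (trans (β-length {ω = ω} {quad ω} shape) (length-upset (swap (quad ω))))
    where
    shape : HasShape ω (quad ω)
    shape = quad-HasShape ω (∈-𝔅⁻ ω∈)

length-𝔅 : ∀ {m n} → 2 + m ≡ n → length (𝔅 n) ≡ conv (power-sum 0) (power-sum 0) m
length-𝔅 {n = n} 2+m≡n = trans (length-as-sum (𝔅 n)) (sum-𝔅 0 0 2+m≡n)

sum-map-mono : ∀ {A : Set} {f g : A → ℕ} → (∀ x → f x ≤ g x) → ∀ xs → sum (map f xs) ≤ sum (map g xs)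
sum-map-mono f≤g []       = z≤n
sum-map-mono f≤g (x ∷ xs) = +-mono-≤ (f≤g x) (sum-map-mono f≤g xs)

conv-mono : ∀ {f f′ g g′} → (∀ a → f a ≤ f′ a) → (∀ b → g b ≤ g′ b) → ∀ n → conv f g n ≤ conv f′ g′ n
conv-mono f≤f′ g≤g′ n = sum-map-mono (λ (a , b) → *-mono-≤ (f≤f′ a) (g≤g′ b)) (antidiagonal n)

conv-suc : ∀ f g n → conv f g (suc n) ≡ f 0 * g (suc n) + conv (f ∘ suc) g n
conv-suc f g = sum-antidiagonal-suc (λ (a , b) → f a * g b)

conv-scale : ∀ c d f g n → conv (λ a → c * f a) (λ b → d * g b) n ≡ c * d * conv f g n
conv-scale c d f g n = trans
  (cong sum (map-cong (λ (a , b) → [m*n]*[o*p]≡[m*o]*[n*p] c (f a) d (g b)) (antidiagonal n)))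
  (sum-*ˡ (c * d) (λ (a , b) → f a * g b) (antidiagonal n))

conv-+ˡ : ∀ f f′ g n → conv (λ a → f a + f′ a) g n ≡ conv f g n + conv f′ g n
conv-+ˡ f f′ g n = go (antidiagonal n)
  where
  lemma : ∀ f f′ g s s′ → (f + f′) * g + (s + s′) ≡ (f * g + s) + (f′ * g + s′)
  lemma = solve-∀
  go : ∀ xs → sum (map (λ (a , b) → (f a + f′ a) * g b) xs) ≡
              sum (map (λ (a , b) → f a * g b) xs) + sum (map (λ (a , b) → f′ a * g b) xs)
  go []             = refl
  go ((a , b) ∷ xs) = trans (cong ((f a + f′ a) * g b +_) (go xs)) (lemma (f a) (f′ a) (g b) _ _)

conv-cong : ∀ {f f′ g g′} → (∀ a → f a ≡ f′ a) → (∀ b → g b ≡ g′ b) → ∀ n → conv f g n ≡ conv f′ g′ n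
conv-cong f≡f′ g≡g′ n = ≤-antisym
  (conv-mono (≤-reflexive ∘ f≡f′) (≤-reflexive ∘ g≡g′) n)
  (conv-mono (≤-reflexive ∘ sym ∘ f≡f′) (≤-reflexive ∘ sym ∘ g≡g′) n)

-- The left side is the right side without the e summands whose first argument is below e.
conv-shiftˡ : ∀ e f g n → conv (λ a → f (e + a)) g n ≤ conv f g (e + n)
conv-shiftˡ zero    f g n = ≤-refl
conv-shiftˡ (suc e) f g n = ≤-trans (conv-shiftˡ e (f ∘ suc) g n)
  (≤-trans (m≤n+m _ (f 0 * g (suc (e + n)))) (≤-reflexive (sym (conv-suc f g (e + n)))))

conv-sucʳ : ∀ f g n → conv f (g ∘ suc) n ≤ conv f g (suc n)
conv-sucʳ f g zero    = +-monoʳ-≤ (f 0 * g 1) z≤n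
conv-sucʳ f g (suc n) = begin
  conv f (g ∘ suc) (suc n)                              ≡⟨ conv-suc f (g ∘ suc) n ⟩
  f 0 * g (2 + n) + conv (f ∘ suc) (g ∘ suc) n          ≤⟨ +-monoʳ-≤ (f 0 * g (2 + n)) (conv-sucʳ (f ∘ suc) g n) ⟩
  f 0 * g (2 + n) + conv (f ∘ suc) g (suc n)            ≡⟨ conv-suc f g (suc n) ⟨
  conv f g (2 + n)                                      ∎
  where open ≤-Reasoning

conv-shiftʳ : ∀ e f g n → conv f (λ b → g (e + b)) n ≤ conv f g (e + n)
conv-shiftʳ zero    f g n = ≤-refl
conv-shiftʳ (suc e) f g n = ≤-trans (conv-shiftʳ e f (g ∘ suc) n) (conv-sucʳ f g (e + n))

conv-shift : ∀ d e f g n → conv (λ a → f (d + a)) (λ b → g (e + b)) n ≤ conv f g (d + (e + n))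
conv-shift d e f g n = ≤-trans (conv-shiftʳ e (λ a → f (d + a)) g n) (conv-shiftˡ d f g (e + n))

-- Growth of convolutions

C-pascal : ∀ n k → suc n C suc k ≡ n C k + n C suc k
C-pascal n k = sym (nCk+nC[k+1]≡[n+1]C[k+1] n k)

hockey-stick : ∀ e n → conv (_C 0) (_C e) n ≡ suc n C suc e
hockey-stick e zero    = trans (+-identityʳ _) (trans (+-identityʳ _)
  (sym (trans (C-pascal 0 e) (trans (cong (0 C e +_) (k>n⇒nCk≡0 {0} {suc e} (s≤s z≤n))) (+-identityʳ (0 C e))))))
hockey-stick e (suc n) = begin
  conv (_C 0) (_C e) (suc n)               ≡⟨ conv-suc (_C 0) (_C e) n ⟩
  1 * (suc n C e) + conv (_C 0) (_C e) n   ≡⟨ cong₂ _+_ (*-identityˡ (suc n C e)) (hockey-stick e n) ⟩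
  suc n C e + suc n C suc e                ≡⟨ C-pascal (suc n) e ⟨
  suc (suc n) C suc e                      ∎
  where open ≡-Reasoning

-- Choosing d + e + 1 of n + 1 points, let a be the number of points before the (d + 1)-st chosen
-- one: d are chosen among those a, and e among the n - a after it. The proof is by induction
-- through Pascal's rule.
vandermonde : ∀ d e n → conv (_C d) (_C e) n ≡ suc n C suc (d + e)
vandermonde zero    e n       = hockey-stick e n
vandermonde (suc d) e zero    = sym (k>n⇒nCk≡0 {1} {suc (suc (d + e))} (s≤s (s≤s z≤n)))
vandermonde (suc d) e (suc n) = begin
  conv (_C suc d) (_C e) (suc n)                    ≡⟨ conv-suc (_C suc d) (_C e) n ⟩
  conv (λ a → suc a C suc d) (_C e) n               ≡⟨ conv-cong (λ a → C-pascal a d) (λ _ → refl) n ⟩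
  conv (λ a → a C d + a C suc d) (_C e) n           ≡⟨ conv-+ˡ (_C d) (_C suc d) (_C e) n ⟩
  conv (_C d) (_C e) n + conv (_C suc d) (_C e) n   ≡⟨ cong₂ _+_ (vandermonde d e n) (vandermonde (suc d) e n) ⟩
  suc n C suc (d + e) + suc n C suc (suc d + e)     ≡⟨ C-pascal (suc n) (suc (d + e)) ⟨
  suc (suc n) C suc (suc d + e)                     ∎
  where open ≡-Reasoning

absorption : ∀ n k → suc k * (suc n C suc k) ≡ suc n * (n C k)
absorption zero    zero    = refl
absorption zero    (suc k) = trans (cong (suc (suc k) *_) (k>n⇒nCk≡0 {1} {suc (suc k)} (s≤s (s≤s z≤n))))
  (trans (*-zeroʳ (suc (suc k))) (sym (cong (_+ 0) (k>n⇒nCk≡0 {0} {suc k} (s≤s z≤n)))))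
absorption (suc n) zero    = begin
  1 * (suc (suc n) C 1)              ≡⟨ *-identityˡ _ ⟩
  suc (suc n) C 1                    ≡⟨ C-pascal (suc n) 0 ⟩
  1 + suc n C 1                      ≡⟨ cong (1 +_) (*-identityˡ (suc n C 1)) ⟨
  1 + 1 * (suc n C 1)                ≡⟨ cong (1 +_) (absorption n zero) ⟩
  1 + suc n * 1                      ∎
  where open ≡-Reasoning
absorption (suc n) (suc k) = begin
  suc (suc k) * (suc (suc n) C suc (suc k))
    ≡⟨ cong (suc (suc k) *_) (C-pascal (suc n) (suc k)) ⟩
  suc (suc k) * (suc n C suc k + suc n C suc (suc k))
    ≡⟨ lemma₁ k (suc n C suc k) (suc n C suc (suc k)) ⟩
  suc n C suc k + (suc k * (suc n C suc k) + suc (suc k) * (suc n C suc (suc k)))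
    ≡⟨ cong (suc n C suc k +_) (cong₂ _+_ (absorption n k) (absorption n (suc k))) ⟩
  suc n C suc k + (suc n * (n C k) + suc n * (n C suc k))
    ≡⟨ cong (suc n C suc k +_) (*-distribˡ-+ (suc n) (n C k) _) ⟨
  suc n C suc k + suc n * (n C k + n C suc k)
    ≡⟨ cong (λ z → suc n C suc k + suc n * z) (C-pascal n k) ⟨
  suc (suc n) * (suc n C suc k) ∎
  where
  open ≡-Reasoning
  lemma₁ : ∀ k x y → suc (suc k) * (x + y) ≡ x + (suc k * x + suc (suc k) * y)
  lemma₁ = solve-∀

!*C-absorption : ∀ n k → (suc k) ! * (suc n C suc k) ≡ suc n * (k ! * (n C k))
!*C-absorption n k = begin
  suc k * k ! * (suc n C suc k)     ≡⟨ lemma (suc k) (k !) _ ⟩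
  k ! * (suc k * (suc n C suc k))   ≡⟨ cong (k ! *_) (absorption n k) ⟩
  k ! * (suc n * (n C k))           ≡⟨ lemma₂ (k !) (suc n) (n C k) ⟩
  suc n * (k ! * (n C k))           ∎
  where
  open ≡-Reasoning
  lemma : ∀ a b c → a * b * c ≡ b * (a * c)
  lemma = solve-∀
  lemma₂ : ∀ a b c → a * (b * c) ≡ b * (a * c)
  lemma₂ = solve-∀

-- A falling factorial is at most a power, and a power at most a rising factorial
-- (`n^k≤k!*[k+n]Ck`). Powers can thus be traded for binomials, whose convolution is exact, at the
-- cost of a shift by k.
k!*nCk≤n^k : ∀ n k → k ! * (n C k) ≤ n ^ k
k!*nCk≤n^k n       zero    = ≤-refl
k!*nCk≤n^k zero    (suc k) = ≤-reflexive
  (trans (cong ((suc k) ! *_) (k>n⇒nCk≡0 {0} {suc k} (s≤s z≤n))) (*-zeroʳ ((suc k) !)))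
k!*nCk≤n^k (suc n) (suc k) = begin
  (suc k) ! * (suc n C suc k)  ≡⟨ !*C-absorption n k ⟩
  suc n * (k ! * (n C k))      ≤⟨ *-monoʳ-≤ (suc n) (≤-trans (k!*nCk≤n^k n k) (^-monoˡ-≤ k (n≤1+n n))) ⟩
  suc n * suc n ^ k            ∎
  where open ≤-Reasoning

[1+n]^k≤k!*[k+n]Ck : ∀ n k → suc n ^ k ≤ k ! * ((k + n) C k)
[1+n]^k≤k!*[k+n]Ck n zero    = ≤-refl
[1+n]^k≤k!*[k+n]Ck n (suc k) = begin
  suc n * suc n ^ k                       ≤⟨ *-mono-≤ (s≤s (m≤n+m n k)) ([1+n]^k≤k!*[k+n]Ck n k) ⟩
  suc (k + n) * (k ! * ((k + n) C k))     ≡⟨ !*C-absorption (k + n) k ⟨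
  (suc k) ! * (suc (k + n) C suc k)       ∎
  where open ≤-Reasoning

n^k≤k!*[k+n]Ck : ∀ n k → n ^ k ≤ k ! * ((k + n) C k)
n^k≤k!*[k+n]Ck n k = ≤-trans (^-monoˡ-≤ k (n≤1+n n)) ([1+n]^k≤k!*[k+n]Ck n k)

-- f(n) ∼ (c / D) n^d, with the error absorbed into a shift of n by e.
record Growth (f : ℕ → ℕ) (c D d e : ℕ) : Set where
  field
    lower : ∀ n → c * n ^ d ≤ D * f (e + n)
    upper : ∀ n → D * f n ≤ c * (e + n) ^ d

open Growth

weaken : ∀ {f c D d} e o → Growth f c D d e → Growth f c D d (e + o)
weaken {f} {c} {D} {d} e o gr .lower n = begin
  c * n ^ d              ≤⟨ *-monoʳ-≤ c (^-monoˡ-≤ d (m≤n+m n o)) ⟩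
  c * (o + n) ^ d        ≤⟨ lower gr (o + n) ⟩
  D * f (e + (o + n))    ≡⟨ cong (λ z → D * f z) (+-assoc e o n) ⟨
  D * f (e + o + n)      ∎
  where open ≤-Reasoning
weaken {f} {c} {D} {d} e o gr .upper n =
  ≤-trans (upper gr n) (*-monoʳ-≤ c (^-monoˡ-≤ d (+-monoˡ-≤ n (m≤m+n e o))))

growth-power : ∀ k e → Growth (λ n → (e + n) ^ k) 1 1 k e
growth-power k e .lower n = *-monoʳ-≤ 1 (^-monoˡ-≤ k (≤-trans (m≤n+m n e) (m≤n+m (e + n) e)))
growth-power k e .upper n = ≤-refl

growth-scale : ∀ {f g c D d e} r → (∀ n → r * f n ≡ g n) → Growth g c D d e → Growth f c (D * r) d e
growth-scale {f} {g} {c} {D} {d} {e} r rf≡g gr = λ where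
    .lower n → ≤-trans (lower gr n) (≤-reflexive (sym (scaled (e + n))))
    .upper n → ≤-trans (≤-reflexive (scaled n)) (upper gr n)
  where
  scaled : ∀ n → D * r * f n ≡ D * g n
  scaled n = trans (*-assoc D r (f n)) (cong (D *_) (rf≡g n))

growth-* : ∀ {f g c D d c′ D′ d′ e} → Growth f c D d e → Growth g c′ D′ d′ e →
           Growth (λ n → f n * g n) (c * c′) (D * D′) (d + d′) e
growth-* {f} {g} {c} {D} {d} {c′} {D′} {d′} {e} F G = λ where
    .lower n → begin
      c * c′ * n ^ (d + d′)             ≡⟨ cong (c * c′ *_) (^-distribˡ-+-* n d d′) ⟩
      c * c′ * (n ^ d * n ^ d′)         ≡⟨ [m*n]*[o*p]≡[m*o]*[n*p] c c′ (n ^ d) (n ^ d′) ⟩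
      c * n ^ d * (c′ * n ^ d′)         ≤⟨ *-mono-≤ (lower F n) (lower G n) ⟩
      D * f (e + n) * (D′ * g (e + n))  ≡⟨ [m*n]*[o*p]≡[m*o]*[n*p] D (f (e + n)) D′ (g (e + n)) ⟩
      D * D′ * (f (e + n) * g (e + n))  ∎
    .upper n → begin
      D * D′ * (f n * g n)                     ≡⟨ [m*n]*[o*p]≡[m*o]*[n*p] D D′ (f n) (g n) ⟩
      D * f n * (D′ * g n)                     ≤⟨ *-mono-≤ (upper F n) (upper G n) ⟩
      c * (e + n) ^ d * (c′ * (e + n) ^ d′)    ≡⟨ [m*n]*[o*p]≡[m*o]*[n*p] c ((e + n) ^ d) c′ ((e + n) ^ d′) ⟩
      c * c′ * ((e + n) ^ d * (e + n) ^ d′)    ≡⟨ cong (c * c′ *_) (^-distribˡ-+-* (e + n) d d′) ⟨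
      c * c′ * (e + n) ^ (d + d′)              ∎
  where open ≤-Reasoning

-- Replace d-th powers by d! times binomials, convolve these by `vandermonde`, and return to powers.
-- The shift adds d + e and d′ + e from the two factors and 1 from the upper index n + 1 in
-- `vandermonde`.
growth-conv : ∀ {f g c D d c′ D′ d′ e} → Growth f c D d e → Growth g c′ D′ d′ e →
              Growth (conv f g) (c * d ! * (c′ * d′ !)) (D * D′ * (suc (d + d′)) !) (suc (d + d′))
                     (suc (d + e + (d′ + e)))
growth-conv {f} {g} {c} {D} {d} {c′} {D′} {d′} {e} F G = λ where
    -- Passing from n to n + 1 first makes the shift here equal to that of the upper bound.
    .lower n → let m = suc (d + d′) + suc n in begin
      c * d ! * (c′ * d′ !) * n ^ suc (d + d′)
        ≤⟨ *-monoʳ-≤ (c * d ! * (c′ * d′ !)) (≤-trans (^-monoˡ-≤ (suc (d + d′)) (n≤1+n n)) (n^k≤k!*[k+n]Ck (suc n) (suc (d + d′)))) ⟩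
      c * d ! * (c′ * d′ !) * ((suc (d + d′)) ! * (m C suc (d + d′)))
        ≡⟨ lemma₁ (c * d ! * (c′ * d′ !)) ((suc (d + d′)) !) (m C suc (d + d′)) ⟩
      (suc (d + d′)) ! * (c * d ! * (c′ * d′ !) * (m C suc (d + d′)))
        ≡⟨ cong (λ z → (suc (d + d′)) ! * (c * d ! * (c′ * d′ !) * z)) (vandermonde d d′ (d + d′ + suc n)) ⟨
      (suc (d + d′)) ! * (c * d ! * (c′ * d′ !) * conv (_C d) (_C d′) (d + d′ + suc n))
        ≡⟨ cong ((suc (d + d′)) ! *_) (conv-scale (c * d !) (c′ * d′ !) (_C d) (_C d′) (d + d′ + suc n)) ⟨
      (suc (d + d′)) ! * conv (λ a → c * d ! * (a C d)) (λ b → c′ * d′ ! * (b C d′)) (d + d′ + suc n)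
        ≤⟨ *-monoʳ-≤ ((suc (d + d′)) !) (conv-mono (below F) (below G) (d + d′ + suc n)) ⟩
      (suc (d + d′)) ! * conv (λ a → D * f (e + a)) (λ b → D′ * g (e + b)) (d + d′ + suc n)
        ≡⟨ cong ((suc (d + d′)) ! *_) (conv-scale D D′ (λ a → f (e + a)) (λ b → g (e + b)) (d + d′ + suc n)) ⟩
      (suc (d + d′)) ! * (D * D′ * conv (λ a → f (e + a)) (λ b → g (e + b)) (d + d′ + suc n))
        ≤⟨ *-monoʳ-≤ ((suc (d + d′)) !) (*-monoʳ-≤ (D * D′) (conv-shift e e f g (d + d′ + suc n))) ⟩
      (suc (d + d′)) ! * (D * D′ * conv f g (e + (e + (d + d′ + suc n))))
        ≡⟨ lemma₂ ((suc (d + d′)) !) (D * D′) _ ⟩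
      D * D′ * (suc (d + d′)) ! * conv f g (e + (e + (d + d′ + suc n)))
        ≡⟨ cong (λ z → D * D′ * (suc (d + d′)) ! * conv f g z) (lemma₃ d e d′ n) ⟩
      D * D′ * (suc (d + d′)) ! * conv f g (suc (d + e + (d′ + e)) + n) ∎
    .upper n → begin
      D * D′ * (suc (d + d′)) ! * conv f g n
        ≡⟨ lemma₂ ((suc (d + d′)) !) (D * D′) _ ⟨
      (suc (d + d′)) ! * (D * D′ * conv f g n)
        ≡⟨ cong ((suc (d + d′)) ! *_) (conv-scale D D′ f g n) ⟨
      (suc (d + d′)) ! * conv (λ a → D * f a) (λ b → D′ * g b) n
        ≤⟨ *-monoʳ-≤ ((suc (d + d′)) !) (conv-mono (above F) (above G) n) ⟩
      (suc (d + d′)) ! * conv (λ a → c * d ! * ((d + e + a) C d)) (λ b → c′ * d′ ! * ((d′ + e + b) C d′)) n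
        ≡⟨ cong ((suc (d + d′)) ! *_) (conv-scale (c * d !) (c′ * d′ !) (λ a → (d + e + a) C d) (λ b → (d′ + e + b) C d′) n) ⟩
      (suc (d + d′)) ! * (c * d ! * (c′ * d′ !) * conv (λ a → (d + e + a) C d) (λ b → (d′ + e + b) C d′) n)
        ≤⟨ *-monoʳ-≤ ((suc (d + d′)) !) (*-monoʳ-≤ (c * d ! * (c′ * d′ !)) (conv-shift (d + e) (d′ + e) (_C d) (_C d′) n)) ⟩
      (suc (d + d′)) ! * (c * d ! * (c′ * d′ !) * conv (_C d) (_C d′) (d + e + (d′ + e + n)))
        ≡⟨ cong (λ z → (suc (d + d′)) ! * (c * d ! * (c′ * d′ !) * z)) (vandermonde d d′ (d + e + (d′ + e + n))) ⟩
      (suc (d + d′)) ! * (c * d ! * (c′ * d′ !) * (suc (d + e + (d′ + e + n)) C suc (d + d′)))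
        ≡⟨ lemma₁ (c * d ! * (c′ * d′ !)) ((suc (d + d′)) !) _ ⟨
      c * d ! * (c′ * d′ !) * ((suc (d + d′)) ! * (suc (d + e + (d′ + e + n)) C suc (d + d′)))
        ≤⟨ *-monoʳ-≤ (c * d ! * (c′ * d′ !)) (k!*nCk≤n^k (suc (d + e + (d′ + e + n))) (suc (d + d′))) ⟩
      c * d ! * (c′ * d′ !) * suc (d + e + (d′ + e + n)) ^ suc (d + d′)
        ≡⟨ cong (λ z → c * d ! * (c′ * d′ !) * suc z ^ suc (d + d′)) (+-assoc (d + e) (d′ + e) n) ⟨
      c * d ! * (c′ * d′ !) * (suc (d + e + (d′ + e)) + n) ^ suc (d + d′) ∎
  where
  open ≤-Reasoning
  lemma₁ : ∀ a b c → a * (b * c) ≡ b * (a * c)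
  lemma₁ = solve-∀
  lemma₂ : ∀ a b c → a * (b * c) ≡ b * a * c
  lemma₂ = solve-∀
  lemma₃ : ∀ d e d′ n → e + (e + (d + d′ + suc n)) ≡ suc (d + e + (d′ + e)) + n
  lemma₃ = solve-∀
  below : ∀ {f c D d e} → Growth f c D d e → ∀ a → c * d ! * (a C d) ≤ D * f (e + a)
  below {c = c} {d = d} F a = ≤-trans
    (≤-trans (≤-reflexive (*-assoc c (d !) (a C d))) (*-monoʳ-≤ c (k!*nCk≤n^k a d))) (lower F a)
  above : ∀ {f c D d e} → Growth f c D d e → ∀ a → D * f a ≤ c * d ! * ((d + e + a) C d)
  above {c = c} {d = d} {e} F a = ≤-trans (upper F a) $ ≤-trans
    (*-monoʳ-≤ c (n^k≤k!*[k+n]Ck (e + a) d))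
    (≤-reflexive (trans (sym (*-assoc c (d !) _)) (cong (λ z → c * d ! * (z C d)) (sym (+-assoc d e a)))))

Growing : (ℕ → ℕ) → ℕ → ℕ → ℕ → Set
Growing f c D d = ∃ (Growth f c D d)

common-shift : ∀ {f g c c′ D D′ d d′} → Growing f c D d → Growing g c′ D′ d′ →
               ∃ λ e → Growth f c D d e × Growth g c′ D′ d′ e
common-shift {g = g} {c′ = c′} {D′ = D′} {d′ = d′} (e , F) (e′ , G) =
  e + e′ , weaken e e′ F , subst (Growth g c′ D′ d′) (+-comm e′ e) (weaken e′ e G)

growing-* : ∀ {f g c D d c′ D′ d′} → Growing f c D d → Growing g c′ D′ d′ →
            Growing (λ n → f n * g n) (c * c′) (D * D′) (d + d′)
growing-* F G = let e , F′ , G′ = common-shift F G in e , growth-* F′ G′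

growing-conv : ∀ {f g c D d c′ D′ d′} → Growing f c D d → Growing g c′ D′ d′ →
               Growing (conv f g) (c * d ! * (c′ * d′ !)) (D * D′ * (suc (d + d′)) !) (suc (d + d′))
growing-conv F G = let e , F′ , G′ = common-shift F G in _ , growth-conv F′ G′

growing-cong : ∀ {f c D d c′ D′ d′} → c ≡ c′ → D ≡ D′ → d ≡ d′ → Growing f c D d → Growing f c′ D′ d′
growing-cong refl refl refl F = F

-- (k!)² / (2k + 1)! comes from convolving two k-th powers and 2^k from halving; the degree is k
-- from the constant factor plus 2k + 1 from the convolution.
growing-power-sum : ∀ k → Growing (power-sum k) (k ! * k !) ((suc (2 * k)) ! * 2 ^ k) (suc (3 * k))
growing-power-sum k = growing-cong (eq-c (k !)) eq-D (eq-d k)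
  (_ , growth-scale (2 ^ k) (power-sum-formula k)
         (proj₂ (growing-* (2 , growth-power k 2) (growing-conv (1 , growth-power k 1) (1 , growth-power k 1)))))
  where
  eq-c : ∀ x → 1 * (1 * x * (1 * x)) ≡ x * x
  eq-c = solve-∀
  eq-k : ∀ k → k + k ≡ 2 * k
  eq-k = solve-∀
  eq-1 : ∀ x → 1 * (1 * 1 * x) ≡ x
  eq-1 = solve-∀
  eq-D : 1 * (1 * 1 * (suc (k + k)) !) * 2 ^ k ≡ (suc (2 * k)) ! * 2 ^ k
  eq-D = cong (_* 2 ^ k) (trans (eq-1 ((suc (k + k)) !)) (cong (λ z → (suc z) !) (eq-k k)))
  eq-d : ∀ k → k + suc (k + k) ≡ suc (3 * k)
  eq-d = solve-∀

-- Leading coefficients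

coefficient : ℕ → ℕ → ℕ
coefficient k ℓ = k ! * k ! * (suc (3 * k)) ! * (ℓ ! * ℓ ! * (suc (3 * ℓ)) !)

scaling : ℕ → ℕ → ℕ
scaling k ℓ = (suc (2 * k)) ! * 2 ^ k * ((suc (2 * ℓ)) ! * 2 ^ ℓ) * (suc (suc (3 * k) + suc (3 * ℓ))) !

growing-total : ∀ k ℓ → Growing (conv (power-sum k) (power-sum ℓ)) (coefficient k ℓ) (scaling k ℓ) (3 * (k + ℓ) + 3)
growing-total k ℓ = growing-cong refl refl (eq k ℓ) (growing-conv (growing-power-sum k) (growing-power-sum ℓ))
  where
  eq : ∀ k ℓ → suc (suc (3 * k) + suc (3 * ℓ)) ≡ 3 * (k + ℓ) + 3
  eq = solve-∀

C-factorial : ∀ a b → ((a + b) C a) * (a ! * b !) ≡ (a + b) !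
C-factorial a b = trans
  (cong₂ _*_ (nCk≡n!/k![n-k]! (m≤m+n a b)) (cong (λ z → a ! * z !) (sym (m+n∸m≡n a b))))
  (m/n*n≡m (k![n∸k]!∣n! (m≤m+n a b)))
  where instance _ = a !* (a + b ∸ a) !≢0

central : ∀ k → (2 * k + 1) * ((2 * k) C k) * (k ! * k !) ≡ (suc (2 * k)) !
central k = begin
  (2 * k + 1) * ((2 * k) C k) * (k ! * k !)   ≡⟨ *-assoc (2 * k + 1) ((2 * k) C k) _ ⟩
  (2 * k + 1) * (((2 * k) C k) * (k ! * k !)) ≡⟨ cong₂ _*_ (+-comm (2 * k) 1) C≡ ⟩
  suc (2 * k) * (2 * k) !                     ∎
  where
  open ≡-Reasoning
  C≡ : ((2 * k) C k) * (k ! * k !) ≡ (2 * k) !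
  C≡ = subst (λ z → (z C k) * (k ! * k !) ≡ z !) (cong (k +_) (sym (+-identityʳ k))) (C-factorial k k)

-- The sum grows like `coefficient` / `scaling` times a power, and |𝔅 n| like n³/6; the quotient has
-- to have leading coefficient 2 / `denominator`, that is, 6 `coefficient` / `scaling`. In the
-- proof, 3 (k + ℓ + 1) is the top factor of the factorial of 3 (k + ℓ) + 3.
constant : ∀ k ℓ → 3 * denominator k ℓ * coefficient k ℓ ≡ scaling k ℓ
constant k ℓ = begin
  3 * denominator k ℓ * coefficient k ℓ
    ≡⟨ cong (λ z → 3 * (z * (k + ℓ + 1) * B * (2 * k + 1) * Cₖ * (2 * ℓ + 1) * Cₗ) * coefficient k ℓ)
         (^-distribˡ-+-* 2 k ℓ) ⟩
  3 * (2 ^ k * 2 ^ ℓ * (k + ℓ + 1) * B * (2 * k + 1) * Cₖ * (2 * ℓ + 1) * Cₗ)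
    * (k ! * k ! * (suc (3 * k)) ! * (ℓ ! * ℓ ! * (suc (3 * ℓ)) !))
    ≡⟨ regroup (2 ^ k) (2 ^ ℓ) (k + ℓ + 1) B (2 * k + 1) Cₖ (2 * ℓ + 1) Cₗ
         (k ! * k !) ((suc (3 * k)) !) (ℓ ! * ℓ !) ((suc (3 * ℓ)) !) ⟩
  (2 * k + 1) * Cₖ * (k ! * k !) * 2 ^ k * ((2 * ℓ + 1) * Cₗ * (ℓ ! * ℓ !) * 2 ^ ℓ)
    * (3 * (k + ℓ + 1) * (B * ((suc (3 * k)) ! * (suc (3 * ℓ)) !)))
    ≡⟨ cong₂ _*_ (cong₂ (λ x y → x * 2 ^ k * (y * 2 ^ ℓ)) (central k) (central ℓ)) top ⟩
  scaling k ℓ ∎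
  where
  open ≡-Reasoning
  B = (3 * (k + ℓ) + 2) C (3 * k + 1)
  Cₖ = (2 * k) C k
  Cₗ = (2 * ℓ) C ℓ
  regroup : ∀ p q s b x c y d u v w z →
            3 * (p * q * s * b * x * c * y * d) * (u * v * (w * z)) ≡
            x * c * u * p * (y * d * w * q) * (3 * s * (b * (v * z)))
  regroup = solve-∀
  sum≡ : ∀ k ℓ → suc (3 * k) + suc (3 * ℓ) ≡ 3 * (k + ℓ) + 2
  sum≡ = solve-∀
  three : ∀ k ℓ → 3 * (k + ℓ + 1) ≡ suc (suc (3 * k) + suc (3 * ℓ))
  three = solve-∀
  top : 3 * (k + ℓ + 1) * (B * ((suc (3 * k)) ! * (suc (3 * ℓ)) !)) ≡ (suc (suc (3 * k) + suc (3 * ℓ))) !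
  top = cong₂ _*_ (three k ℓ) (trans
    (cong₂ (λ x y → (x C y) * ((suc (3 * k)) ! * (suc (3 * ℓ)) !)) (sym (sum≡ k ℓ)) (+-comm (3 * k) 1))
    (C-factorial (suc (3 * k)) (suc (3 * ℓ))))

scaling≢0 : ∀ k ℓ → NonZero (scaling k ℓ)
scaling≢0 k ℓ = m*n≢0 _ _
  {{m*n≢0 _ _ {{m*n≢0 _ _ {{(suc (2 * k)) !≢0}} {{m^n≢0 2 k}}}}
              {{m*n≢0 _ _ {{(suc (2 * ℓ)) !≢0}} {{m^n≢0 2 ℓ}}}}}}
  {{(suc (suc (3 * k) + suc (3 * ℓ))) !≢0}}

-- From growth to closeness of ratios

powers-close : ∀ d v e → ∃ λ T → ∀ t → T ≤ t → v * (e + t) ^ d < suc v * t ^ d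
powers-close zero    v e = 0 , λ t _ → *-monoˡ-< 1 (n<1+n v)
powers-close (suc d) v e with T , close ← powers-close d (suc (2 * v)) e =
  T ⊔ suc (w * e) , λ t T≤t → step t (≤-trans (m≤m⊔n T _) T≤t) (≤-trans (m≤n⊔m T _) T≤t)
  where
  -- The factor 1 + 1/v has room for (1 + 1/w)²: one factor for (e + t) / t, which is below it once
  -- t > w e, and one for the d-th power by induction. `slack` computes the room left.
  w = suc (2 * v)
  module _ t (T≤t : T ≤ t) (we<t : suc (w * e) ≤ t) where
    linear : w * (e + t) < suc w * t
    linear = ≤-trans (s≤s (≤-reflexive (*-distribˡ-+ w e t))) (+-monoˡ-≤ (w * t) we<t)

    t≢0 : NonZero t
    t≢0 = >-nonZero (≤-trans (s≤s z≤n) we<t)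

    both : w * w * (e + t) ^ suc d < suc w * suc w * t ^ suc d
    both = subst₂ _<_ ([m*n]*[o*p]≡[m*o]*[n*p] w (e + t) w _) ([m*n]*[o*p]≡[m*o]*[n*p] (suc w) t (suc w) _)
      (*-mono-< linear (close t T≤t))

    slack : ∀ v → suc v * (suc (2 * v) * suc (2 * v)) ≡ suc (v + v * (suc (suc (2 * v)) * suc (suc (2 * v))))
    slack = solve-∀

    step : v * (e + t) ^ suc d < suc v * t ^ suc d
    step = *-cancelˡ-< (w * w) _ _ $ begin-strict
      w * w * (v * (e + t) ^ suc d)         ≡⟨ swap₁ (w * w) v _ ⟩
      v * (w * w * (e + t) ^ suc d)         ≤⟨ *-monoʳ-≤ v (<⇒≤ both) ⟩
      v * (suc w * suc w * t ^ suc d)       ≡⟨ *-assoc v (suc w * suc w) (t ^ suc d) ⟨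
      v * (suc w * suc w) * t ^ suc d       <⟨ *-monoˡ-< (t ^ suc d) {{m^n≢0 t (suc d) {{t≢0}}}}
                                                 (≤-trans (s≤s (m≤n+m _ v)) (≤-reflexive (sym (slack v)))) ⟩
      suc v * (w * w) * t ^ suc d           ≡⟨ swap₂ (suc v) (w * w) _ ⟩
      w * w * (suc v * t ^ suc d)           ∎
      where
      open ≤-Reasoning
      swap₁ : ∀ a b c → a * (b * c) ≡ b * (a * c)
      swap₁ = solve-∀
      swap₂ : ∀ a b c → a * b * c ≡ b * (a * c)
      swap₂ = solve-∀

-- x / y and y / x are less than 1 + 1 / v.
CloseAt : ℕ → ℕ → ℕ → Set
CloseAt v x y = v * x < suc v * y × v * y < suc v * x

squeeze : ∀ {v x y l u} → l ≤ x → x ≤ u → l ≤ y → y ≤ u → v * u < suc v * l → CloseAt v x y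
squeeze {v} l≤x x≤u l≤y y≤u close =
  (≤-<-trans (*-monoʳ-≤ v x≤u) (<-≤-trans close (*-monoʳ-≤ (suc v) l≤y))) ,
  (≤-<-trans (*-monoʳ-≤ v y≤u) (<-≤-trans close (*-monoʳ-≤ (suc v) l≤x)))

module _ {S K : ℕ → ℕ} {c D b d : ℕ} .{{_ : NonZero D}} (constant : 3 * b * c ≡ D)
         (S-growing : Growing S c D (d + 3)) (K-growing : Growing K 1 6 3) where

  private
    D*-≡ : ∀ x → D * x ≡ c * x * (3 * b)
    D*-≡ x = trans (cong (_* x) (sym constant)) (rotate (3 * b) c x)
      where
      rotate : ∀ a b c → a * b * c ≡ b * c * a
      rotate = solve-∀

    clear-≤ : ∀ {x y} → c * x * (3 * b) ≤ D * y → x ≤ y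
    clear-≤ {x} {y} h = *-cancelˡ-≤ D (≤-trans (≤-reflexive (D*-≡ x)) h)

    clear-≥ : ∀ {x y} → D * y ≤ c * x * (3 * b) → y ≤ x
    clear-≥ {x} {y} h = *-cancelˡ-≤ D (≤-trans h (≤-reflexive (sym (D*-≡ x))))

    move : ∀ D s n → D * s * (3 * n) ≡ D * (3 * (s * n))
    move = solve-∀

    six : ∀ x y → 3 * (x * (2 * y)) ≡ y * (6 * x)
    six = solve-∀

    module Bounds {e} (s : Growth S c D (d + 3) e) (κ : Growth K 1 6 3 e) (t : ℕ) where
      open ≤-Reasoning
      -- The lower bounds see only t; u is large enough both for the shift e + m of the upper bounds
      -- and for n = 2 + m.
      m = e + t
      u = 2 + e + e + t

      e+m≤u : e + m ≤ u
      e+m≤u = ≤-trans (≤-reflexive (sym (+-assoc e e t))) (m≤n+m (e + e + t) 2)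

      2+m≤u : 2 + m ≤ u
      2+m≤u = +-monoʳ-≤ 2 (≤-trans (m≤n+m m e) (≤-reflexive (sym (+-assoc e e t))))

      S-lower : t ^ (d + 3) ≤ 3 * (S m * b)
      S-lower = clear-≤ (≤-trans (*-monoˡ-≤ (3 * b) (Growth.lower s t)) (≤-reflexive (move D (S m) b)))

      S-upper : 3 * (S m * b) ≤ u ^ (d + 3)
      S-upper = clear-≥ (≤-trans (≤-reflexive (sym (move D (S m) b))) (*-monoˡ-≤ (3 * b)
        (≤-trans (Growth.upper s m) (*-monoʳ-≤ c (^-monoˡ-≤ (d + 3) e+m≤u)))))

      K-lower : t ^ (d + 3) ≤ 3 * (K m * (2 * (2 + m) ^ d))
      K-lower = begin
        t ^ (d + 3)                    ≡⟨ ^-distribˡ-+-* t d 3 ⟩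
        t ^ d * t ^ 3                  ≡⟨ cong (t ^ d *_) (*-identityˡ (t ^ 3)) ⟨
        t ^ d * (1 * t ^ 3)            ≤⟨ *-mono-≤ (^-monoˡ-≤ d (≤-trans (m≤n+m t e) (m≤n+m m 2)))
                                            (Growth.lower κ t) ⟩
        (2 + m) ^ d * (6 * K m)        ≡⟨ six (K m) ((2 + m) ^ d) ⟨
        3 * (K m * (2 * (2 + m) ^ d))  ∎

      K-upper : 3 * (K m * (2 * (2 + m) ^ d)) ≤ u ^ (d + 3)
      K-upper = begin
        3 * (K m * (2 * (2 + m) ^ d))  ≡⟨ six (K m) ((2 + m) ^ d) ⟩
        (2 + m) ^ d * (6 * K m)        ≤⟨ *-mono-≤ (^-monoˡ-≤ d 2+m≤u) (Growth.upper κ m) ⟩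
        u ^ d * (1 * (e + m) ^ 3)      ≡⟨ cong (u ^ d *_) (*-identityˡ ((e + m) ^ 3)) ⟩
        u ^ d * (e + m) ^ 3            ≤⟨ *-monoʳ-≤ (u ^ d) (^-monoˡ-≤ 3 e+m≤u) ⟩
        u ^ d * u ^ 3                  ≡⟨ ^-distribˡ-+-* u d 3 ⟨
        u ^ (d + 3)                    ∎

  -- These are the cross-multiplied numerator and denominator of (S / K) / (2 n^d / b). The factor 3
  -- normalises the leading coefficient of both to 1, since 3 b c = D and 3 · 2 = 6, so both lie
  -- between t^(d + 3) and u^(d + 3).
  growing⇒CloseAt : ∀ v → ∃ λ M → ∀ m → M ≤ m →
                    CloseAt v (3 * (S m * b)) (3 * (K m * (2 * (2 + m) ^ d)))
  growing⇒CloseAt v with e , s , κ ← common-shift S-growing K-growing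
    with T , close ← powers-close (d + 3) v (2 + e + e) = e + T , bound
    where
    bound : ∀ m → e + T ≤ m → CloseAt v (3 * (S m * b)) (3 * (K m * (2 * (2 + m) ^ d)))
    bound m e+T≤m with t , refl ← m≤n⇒∃[o]m+o≡n (≤-trans (m≤m+n e T) e+T≤m) =
      squeeze {v} S-lower S-upper K-lower K-upper (close t (+-cancelˡ-≤ e T t e+T≤m))
      where open Bounds s κ t

totals-close : ∀ k ℓ v → ∃ λ M → ∀ m → M ≤ m →
  CloseAt v (3 * (conv (power-sum k) (power-sum ℓ) m * denominator k ℓ))
            (3 * (conv (power-sum 0) (power-sum 0) m * (2 * (2 + m) ^ (3 * (k + ℓ)))))
-- For k = ℓ = 0 the coefficient and the scaling evaluate to 1 and 6.
totals-close k ℓ = growing⇒CloseAt {{scaling≢0 k ℓ}} (constant k ℓ) (growing-total k ℓ) (growing-total 0 0)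

-- Rational estimates

open import Data.Integer.Base as ℤ using (+_; +[1+_])
import Data.Integer.Properties as ℤ
open import Data.Rational.Base as ℚ using (ℚ; mkℚ; 0ℚ; 1ℚ; _/_; _÷_; _-_; ∣_∣; toℚᵘ)
import Data.Rational.Properties as ℚ
open import Data.Rational.Unnormalised.Base as ℚᵘ using (ℚᵘ; mkℚᵘ)
import Data.Rational.Unnormalised.Properties as ℚᵘ
open import Algebra.Properties.Group ℚ.+-0-group using (⁻¹-anti-homo-//)

<-+⇒-< : ∀ x y {z} → x ℚ.< y ℚ.+ z → x - y ℚ.< z
<-+⇒-< x y {z} x<y+z = begin-strict
  x - y                 <⟨ ℚ.+-monoˡ-< (ℚ.- y) x<y+z ⟩
  y ℚ.+ z - y           ≡⟨ cong (_- y) (ℚ.+-comm y z) ⟩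
  z ℚ.+ y - y           ≡⟨ ℚ.+-assoc z y (ℚ.- y) ⟩
  z ℚ.+ (y - y)         ≡⟨ cong (z ℚ.+_) (ℚ.+-inverseʳ y) ⟩
  z ℚ.+ 0ℚ              ≡⟨ ℚ.+-identityʳ z ⟩
  z                     ∎
  where open ℚ.≤-Reasoning

∣-∣-< : ∀ x y {z} → x ℚ.< y ℚ.+ z → y ℚ.< x ℚ.+ z → ∣ x - y ∣ ℚ.< z
∣-∣-< x y {z} x<y+z y<x+z with ℚ.∣p∣≡p∨∣p∣≡-p (x - y)
... | inj₁ eq = subst (ℚ._< z) (sym eq) (<-+⇒-< x y x<y+z)
... | inj₂ eq = subst (ℚ._< z) (sym (trans eq (⁻¹-anti-homo-// x y))) (<-+⇒-< y x y<x+z)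

module _ (f g δ : ℚ) (g>0 : ℚ.Positive g) where

  private instance
    _ = g>0
    _ = ℚ.pos⇒nonZero g
    _ = ℚ.pos⇒nonNeg g

  ÷-close : f ℚ.< g ℚ.+ δ ℚ.* g → g ℚ.< f ℚ.+ δ ℚ.* g → ∣ (f ÷ g) - 1ℚ ∣ ℚ.< δ
  ÷-close f< g< = ∣-∣-< r 1ℚ
    (ℚ.*-cancelʳ-<-nonNeg g (subst₂ ℚ._<_ (sym r*g≡f) (sym (trans (ℚ.*-distribʳ-+ g 1ℚ δ)
      (cong (ℚ._+ δ ℚ.* g) (ℚ.*-identityˡ g)))) f<))
    (ℚ.*-cancelʳ-<-nonNeg g (subst₂ ℚ._<_ (sym (ℚ.*-identityˡ g)) (sym (trans (ℚ.*-distribʳ-+ g r δ)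
      (cong (ℚ._+ δ ℚ.* g) r*g≡f))) g<))
    where
    r = f ÷ g
    r*g≡f : r ℚ.* g ≡ f
    r*g≡f = trans (ℚ.*-assoc f (ℚ.1/ g) g)
      (trans (cong (f ℚ.*_) (ℚ.*-inverseˡ g)) (ℚ.*-identityʳ f))

module _ (S K A B a v : ℕ) where

  private
    F G Δ : ℚᵘ
    F = mkℚᵘ (+ S) K
    G = mkℚᵘ (+ A) B
    Δ = mkℚᵘ +[1+ a ] v
    K′ = suc K
    B′ = suc B
    v′ = suc v
    a′ = suc a

    numerator : ∀ x m y z n → (+ x ℤ.* + m) ℤ.+ (+ y ℤ.* + z) ℤ.* + n ≡ + (x * m + y * z * n)
    numerator x m y z n = begin
      (+ x ℤ.* + m) ℤ.+ (+ y ℤ.* + z) ℤ.* + n  ≡⟨ cong₂ (λ p q → p ℤ.+ q ℤ.* + n) (sym (ℤ.pos-* x m)) (sym (ℤ.pos-* y z)) ⟩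
      + (x * m) ℤ.+ + (y * z) ℤ.* + n          ≡⟨ cong (λ p → + (x * m) ℤ.+ p) (ℤ.pos-* (y * z) n) ⟨
      + (x * m) ℤ.+ + (y * z * n)              ≡⟨ ℤ.pos-+ (x * m) _ ⟨
      + (x * m + y * z * n)                    ∎
      where open ≡-Reasoning

  -- Δ = a′ / v′ with a′ ≥ 1, so an error of G / v′ is within the allowance. The primes undo the
  -- predecessor encoding of denominators.
  F<G+ΔG : v′ * (S * B′) < suc v′ * (K′ * A) → F ℚᵘ.< G ℚᵘ.+ Δ ℚᵘ.* G
  F<G+ΔG h = ℚᵘ.*<* (subst₂ ℤ._<_ (ℤ.pos-* S (B′ * (v′ * B′)))
    (trans (ℤ.pos-* (A * (v′ * B′) + a′ * A * B′) K′) (cong (ℤ._* + K′) (sym (numerator A (v′ * B′) a′ A B′))))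
    (ℤ.+<+ (begin-strict
      S * (B′ * (v′ * B′))                   ≡⟨ lemma₁ S B′ v′ ⟩
      v′ * (S * B′) * B′                     <⟨ *-monoˡ-< B′ h ⟩
      suc v′ * (K′ * A) * B′                 ≤⟨ *-monoˡ-≤ B′ (*-monoˡ-≤ (K′ * A) (s≤s (m≤n+m v′ a))) ⟩
      (a′ + v′) * (K′ * A) * B′              ≡⟨ lemma₂ A B′ v′ a′ K′ ⟩
      (A * (v′ * B′) + a′ * A * B′) * K′     ∎)))
    where
    open ≤-Reasoning
    lemma₁ : ∀ S B v → S * (B * (v * B)) ≡ v * (S * B) * B
    lemma₁ = solve-∀
    lemma₂ : ∀ A B v a K → (a + v) * (K * A) * B ≡ (A * (v * B) + a * A * B) * K
    lemma₂ = solve-∀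

  G<F+ΔG : v′ * (K′ * A) < v′ * (S * B′) + K′ * A → G ℚᵘ.< F ℚᵘ.+ Δ ℚᵘ.* G
  G<F+ΔG h = ℚᵘ.*<* (subst₂ ℤ._<_ (ℤ.pos-* A (K′ * (v′ * B′)))
    (trans (ℤ.pos-* (S * (v′ * B′) + a′ * A * K′) B′) (cong (ℤ._* + B′) (sym (numerator S (v′ * B′) a′ A K′))))
    (ℤ.+<+ (begin-strict
      A * (K′ * (v′ * B′))                          ≡⟨ lemma₁ A K′ v′ B′ ⟩
      v′ * (K′ * A) * B′                            <⟨ *-monoˡ-< B′ h ⟩
      (v′ * (S * B′) + K′ * A) * B′                 ≤⟨ *-monoˡ-≤ B′ (+-monoʳ-≤ (v′ * (S * B′)) (m≤n*m (K′ * A) a′)) ⟩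
      (v′ * (S * B′) + a′ * (K′ * A)) * B′          ≡⟨ lemma₂ A B′ v′ a′ K′ S ⟩
      (S * (v′ * B′) + a′ * A * K′) * B′            ∎)))
    where
    open ≤-Reasoning
    lemma₁ : ∀ A K v B → A * (K * (v * B)) ≡ v * (K * A) * B
    lemma₁ = solve-∀
    lemma₂ : ∀ A B v a K S → (v * (S * B) + a * (K * A)) * B ≡ (S * (v * B) + a * A * K) * B
    lemma₂ = solve-∀

toℚᵘ-/ : ∀ S K → toℚᵘ (+ S / suc K) ℚᵘ.≃ mkℚᵘ (+ S) K
toℚᵘ-/ S K = ℚ.toℚᵘ-fromℚᵘ (mkℚᵘ (+ S) K)

module _ (f g δ : ℚ) {F G : ℚᵘ} (f≃F : toℚᵘ f ℚᵘ.≃ F) (g≃G : toℚᵘ g ℚᵘ.≃ G) where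

  private
    sum≃ : ∀ h {H} → toℚᵘ h ℚᵘ.≃ H → toℚᵘ (h ℚ.+ δ ℚ.* g) ℚᵘ.≃ H ℚᵘ.+ toℚᵘ δ ℚᵘ.* G
    sum≃ h h≃H = ℚᵘ.≃-trans (ℚ.toℚᵘ-homo-+ h (δ ℚ.* g))
      (ℚᵘ.+-cong h≃H (ℚᵘ.≃-trans (ℚ.toℚᵘ-homo-* δ g) (ℚᵘ.*-congˡ {toℚᵘ δ} g≃G)))

  <-from-ℚᵘ : ∀ h k {H K} → toℚᵘ h ℚᵘ.≃ H → toℚᵘ k ℚᵘ.≃ K →
              H ℚᵘ.< K ℚᵘ.+ toℚᵘ δ ℚᵘ.* G → h ℚ.< k ℚ.+ δ ℚ.* g
  <-from-ℚᵘ h k h≃H k≃K H< = ℚ.toℚᵘ-cancel-<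
    (ℚᵘ.<-respˡ-≃ (ℚᵘ.≃-sym h≃H) (ℚᵘ.<-respʳ-≃ (ℚᵘ.≃-sym (sum≃ k k≃K)) H<))

-- The error has to be relative to y. If x ≤ y, the slack x is at most y; if y ≤ x, the bound only
-- needs y > 0, which follows from the first half of closeness.
close⇒<+ : ∀ v {x y} → CloseAt v x y → v * y < v * x + y
close⇒<+ v {x} {y} (vx< , vy<) with ≤-total x y
... | inj₁ x≤y = <-≤-trans vy< (≤-trans (+-monoˡ-≤ (v * x) x≤y) (≤-reflexive (+-comm y (v * x))))
... | inj₂ y≤x = ≤-<-trans (*-monoʳ-≤ v y≤x)
  (m<m+n (v * x) (n≢0⇒n>0 λ y≡0 → n≮0 (subst (v * x <_) (trans (cong (suc v *_) y≡0) (*-zeroʳ (suc v))) vx<)))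

CloseAt-cancel : ∀ c v {x y} → CloseAt v (c * x) (c * y) → CloseAt v x y
CloseAt-cancel c v {x} {y} (h , h′) = cancel h , cancel h′
  where
  commute : ∀ a b c → a * (b * c) ≡ b * (a * c)
  commute = solve-∀
  cancel : ∀ {x y} → v * (c * x) < suc v * (c * y) → v * x < suc v * y
  cancel {x} {y} h = *-cancelˡ-< c _ _ (subst₂ _<_ (commute v c x) (commute (suc v) c y) h)

ratio-close : ∀ S K A B δ v → .{{_ : NonZero K}} → .{{_ : NonZero A}} → .{{_ : NonZero B}} →
              ∀ a → toℚᵘ δ ≡ mkℚᵘ +[1+ a ] v → CloseAt (suc v) (S * B) (K * A) →
              Σ (ℚ.NonZero (+ A / B)) λ g≢0 → ∣ ((+ S / K) ÷ (+ A / B)) {{g≢0}} - 1ℚ ∣ ℚ.< δ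
ratio-close S (suc K) (suc A) (suc B) δ v a δ≡ close =
  ℚ.pos⇒nonZero g {{g>0}} ,
  ÷-close f g δ g>0
    (<-from-ℚᵘ f g δ (toℚᵘ-/ S K) (toℚᵘ-/ (suc A) B) f g (toℚᵘ-/ S K) (toℚᵘ-/ (suc A) B)
      (subst (λ Δ → F ℚᵘ.< G ℚᵘ.+ Δ ℚᵘ.* G) (sym δ≡) (F<G+ΔG S K (suc A) B a v (proj₁ close))))
    (<-from-ℚᵘ f g δ (toℚᵘ-/ S K) (toℚᵘ-/ (suc A) B) g f (toℚᵘ-/ (suc A) B) (toℚᵘ-/ S K)
      (subst (λ Δ → G ℚᵘ.< F ℚᵘ.+ Δ ℚᵘ.* G) (sym δ≡) (G<F+ΔG S K (suc A) B a v (close⇒<+ (suc v) close))))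
  where
  f = + S / suc K
  g = + suc A / suc B
  F = mkℚᵘ (+ S) K
  G = mkℚᵘ (+ suc A) B
  g>0 : ℚ.Positive g
  g>0 = ℚ.normalize-pos (suc A) (suc B)

average-/ : ∀ xs s k → .{{_ : NonZero k}} → sum xs ≡ s → length xs ≡ k → average xs ≡ + s / k
average-/ []       s .0 {{()}} _ refl
average-/ (_ ∷ _) _ _ refl refl = refl

theorem4p2 : (k ℓ : ℕ) →
    (λ n → 𝔼 n (λ ω → α ω ^ k * β ω ^ ℓ))
    ∼ (λ n → (+ (2 * n ^ (3 * (k + ℓ))) / denominator k ℓ) {{denominator≢0 k ℓ}})
theorem4p2 k ℓ δ@(mkℚ (+ 0) _ _) (ℚ.*<* (ℤ.+<+ ()))
-- δ = (a + 1) / (v + 1) is at least 1 / (v + 1), so closeness with parameter v + 1 suffices.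
theorem4p2 k ℓ δ@(mkℚ +[1+ a ] v c) 0<δ = 2 + M , λ n 2+M≤n →
  let m = n ∸ 2
      2+m≡n = m+[n∸m]≡n (≤-trans (m≤m+n 2 M) 2+M≤n)
      close = CloseAt-cancel 3 (suc v)
        (subst (λ z → CloseAt (suc v) (3 * (conv (power-sum k) (power-sum ℓ) m * denominator k ℓ))
                                      (3 * (conv (power-sum 0) (power-sum 0) m * (2 * z ^ (3 * (k + ℓ))))))
               2+m≡n (bound m (m+n≤o⇒m≤o∸n M (≤-trans (≤-reflexive (+-comm M 2)) 2+M≤n))))
  in  final n m 2+m≡n close
  where
  M = proj₁ (totals-close k ℓ (suc v))
  bound = proj₂ (totals-close k ℓ (suc v))

  final : ∀ n m → 2 + m ≡ n →
          CloseAt (suc v) (conv (power-sum k) (power-sum ℓ) m * denominator k ℓ)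
                          (conv (power-sum 0) (power-sum 0) m * (2 * n ^ (3 * (k + ℓ)))) →
          Σ (ℚ.NonZero ((+ (2 * n ^ (3 * (k + ℓ))) / denominator k ℓ) {{denominator≢0 k ℓ}})) λ g≢0 →
          ∣ (𝔼 n (λ ω → α ω ^ k * β ω ^ ℓ)
              ÷ ((+ (2 * n ^ (3 * (k + ℓ))) / denominator k ℓ) {{denominator≢0 k ℓ}})) {{g≢0}} - 1ℚ ∣ ℚ.< δ
  final n m 2+m≡n close = subst
    (λ e → Σ (ℚ.NonZero ((+ A / B))) λ g≢0 → ∣ (e ÷ (+ A / B)) {{g≢0}} - 1ℚ ∣ ℚ.< δ)
    (sym (average-/ (map (λ ω → α ω ^ k * β ω ^ ℓ) (𝔅 n)) S K
      (sum-𝔅 k ℓ 2+m≡n) (trans (length-map _ (𝔅 n)) (length-𝔅 2+m≡n))))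
    (ratio-close S K A B δ v a refl close)
    where
    S = conv (power-sum k) (power-sum ℓ) m
    K = conv (power-sum 0) (power-sum 0) m
    A = 2 * n ^ (3 * (k + ℓ))
    B = denominator k ℓ
    instance
      A≢0 : NonZero A
      A≢0 = m*n≢0 2 (n ^ (3 * (k + ℓ))) {{_}} {{m^n≢0 n (3 * (k + ℓ)) {{>-nonZero (≤-trans (s≤s z≤n) (≤-reflexive 2+m≡n))}}}}
      B≢0 : NonZero B
      B≢0 = denominator≢0 k ℓ
      -- If 𝔅 n were empty, the right side of the first closeness inequality would vanish.
      K≢0 : NonZero K
      K≢0 = ≢-nonZero λ K≡0 → n≮0 (subst (suc v * (S * B) <_)
        (trans (cong (λ z → suc (suc v) * (z * A)) K≡0) (*-zeroʳ (suc (suc v)))) (proj₁ close))
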